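{- For any $\epsilon > 0$ the following holds for all sufficiently large integers $r$: there is an online randomized algorithm that $r$-colors the edges arriving in $(1-\epsilon)rn$ rounds of the online random edge process on $n$ vertices such that, with high probability, every connected component of every color class has order $o(n)$.
   Context: Online random edge process: there are $n$ vertices and a sequence of rounds; in each round one edge arrives, chosen uniformly at random among all pairs of distinct vertices, independently of previous rounds (repetitions are possible and need not be recolored). The algorithm must assign a color to each edge upon its arrival, using only the history of the process so far (and, if randomized, its own independent random bits). "With high probability" means with probability tending to $1$ as $n\to\infty$. -}

module Defs where

open import Data.Nat as ℕ using (ℕ; zero; suc; _^_)
open import Data.Nat.Combinatorics using (_C_)
open import Data.Fin using (Fin) renaming (_<_ to _<ᶠ_)
open import Data.Product using (Σ; ∃; ∃-syntax; _×_; _,_)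
open import Data.Sum using (_⊎_)
open import Data.List using (List; []; _∷_; _++_; [_]; length)
open import Data.List.Relation.Unary.All using (All)
open import Data.List.Relation.Unary.Unique.Propositional using (Unique)
open import Data.List.Membership.Propositional using (_∈_)
open import Data.Vec using (Vec; toList)
open import Relation.Binary.PropositionalEquality using (_≡_)
open import Relation.Binary.Construct.Closure.ReflexiveTransitive using (Star)
open import Data.Integer using (ℤ; +_; -[1+_])
open import Data.Rational using (ℚ; floor; _/_; 0ℚ; 1ℚ; _-_; _*_; _≤_; _<_)

record Edge (n : ℕ) : Set where
  constructor edge
  field
    u : Fin n
    v : Fin n
    u<v : u <ᶠ v

-- An online randomized algorithm using r colours on n vertices.
-- In every round it draws a fresh independent uniform random seed from
-- Fin (suc seeds).  The colour of the arriving edge is a function of the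
-- history (previous edges together with the previous seeds, from which the
-- previous colours can be recomputed), the arriving edge and the fresh seed.
record OnlineAlgorithm (n r : ℕ) : Set where
  field
    seeds  : ℕ
    colour : List (Edge n × Fin (suc seeds)) → Edge n → Fin (suc seeds) → Fin r

open OnlineAlgorithm public

-- Outcomes of T rounds: the arriving edges and the algorithm's seeds.
-- The probability space is uniform on this set (edges uniform and
-- independent, seeds uniform and independent).
Outcome : {n r : ℕ} → OnlineAlgorithm n r → ℕ → Set
Outcome {n} A T = Vec (Edge n × Fin (suc (seeds A))) T

outcomeCount : {n r : ℕ} → OnlineAlgorithm n r → ℕ → ℕ
outcomeCount {n} A T = ((n C 2) ℕ.* suc (seeds A)) ^ T

runFrom : {n r : ℕ} (A : OnlineAlgorithm n r) →
          List (Edge n × Fin (suc (seeds A))) →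
          List (Edge n × Fin (suc (seeds A))) → List (Edge n × Fin r)
runFrom A hist [] = []
runFrom A hist ((e , s) ∷ rest) = (e , colour A hist e s) ∷ runFrom A (hist ++ [ (e , s) ]) rest

run : {n r : ℕ} (A : OnlineAlgorithm n r) {T : ℕ} → Outcome A T → List (Edge n × Fin r)
run A ω = runFrom A [] (toList ω)

Adj : {n r : ℕ} → List (Edge n × Fin r) → Fin r → Fin n → Fin n → Set
Adj L c x y = ∃[ e ] ((e , c) ∈ L ×
  ((Edge.u e ≡ x × Edge.v e ≡ y) ⊎ (Edge.u e ≡ y × Edge.v e ≡ x)))

Connected : {n r : ℕ} → List (Edge n × Fin r) → Fin r → Fin n → Fin n → Set
Connected L c = Star (Adj L c)

ComponentsBoundedBy : {n r : ℕ} → ℕ → List (Edge n × Fin r) → Set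
ComponentsBoundedBy {n} {r} k L =
  (c : Fin r) (x : Fin n) (ys : List (Fin n)) →
  Unique ys → All (Connected L c x) ys → length ys ℕ.≤ k

-- Pr[P] ≥ p for the uniform measure on a finite set Ω of the given size:
-- there are at least p·|Ω| distinct outcomes satisfying P.
ProbAtLeast : (Ω : Set) → ℕ → (Ω → Set) → ℚ → Set
ProbAtLeast Ω size P p =
  ∃[ L ] (Unique {A = Ω} L × All P L × p * (+ size / 1) ≤ (+ length L / 1))

ℤ⁺ : ℤ → ℕ
ℤ⁺ (+ m) = m
ℤ⁺ -[1+ _ ] = 0

rounds : ℚ → ℕ → ℕ → ℕ
rounds ε r n = ℤ⁺ (floor ((1ℚ - ε) * (+ (r ℕ.* n) / 1)))

LittleO : (ℕ → ℕ) → Set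
LittleO f = (δ : ℚ) → 0ℚ < δ → ∃[ N ] ((n : ℕ) → N ℕ.≤ n → (+ f n / 1) ≤ δ * (+ n / 1))

WHP : (Ω : ℕ → Set) (size : ℕ → ℕ) (P : (n : ℕ) → Ω n → Set) → Set
WHP Ω size P = (η : ℚ) → 0ℚ < η →
  ∃[ N ] ((n : ℕ) → N ℕ.≤ n → ProbAtLeast (Ω n) (size n) (P n) (1ℚ - η))

{-# OPTIONS --safe #-}
module Submission where

open import Defs
open import Data.Nat
open import Data.Nat.Properties
open import Data.Nat.Combinatorics using (_C_; nC1≡n; nCk+nC[k+1]≡[n+1]C[k+1])
open import Data.Nat.Coprimality using (1-coprimeTo) renaming (sym to coprime-sym)
open import Data.Nat.DivMod using (_/_; _%_; m≡m%n+[m/n]*n; m%n<n; m/n*n≤m; m≥n⇒m/n>0; /-monoˡ-≤)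
open import Data.Nat.Tactic.RingSolver using (solve-∀)
import Data.Integer as ℤ
import Data.Integer.Properties as ℤ
import Data.Integer.DivMod as ℤ
open import Data.Rational as ℚ using (ℚ; mkℚ; 0ℚ; 1ℚ)
import Data.Rational.Properties as ℚ
import Data.Rational.Unnormalised as ℚᵘ
import Data.Rational.Unnormalised.Properties as ℚᵘ
open import Data.Bool using (Bool; true; false)
open import Data.Unit using (⊤; tt)
open import Data.Empty using (⊥-elim)
open import Data.Product using (Σ; _×_; _,_; proj₁; proj₂; ∃-syntax; uncurry)
open import Data.Sum using (_⊎_; inj₁; inj₂)
open import Data.Fin using (Fin; toℕ; fromℕ<)
import Data.Fin as Fin
import Data.Fin.Properties as Fin
open import Data.Vec using (Vec; []; _∷_; toList)
import Data.Vec.Properties as Vec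
open import Data.List using (List; []; _∷_; _++_; [_]; length; map; concatMap; filter; allFin; upTo; applyUpTo; cartesianProductWith; cartesianProduct; _ʳ++_)
open import Data.List.Properties using (length-map; length-tabulate; length-upTo)
open import Data.List.Membership.Propositional using (_∈_; lose)
import Data.List.Membership.Propositional.Properties as Memb
open import Data.List.Membership.DecPropositional using (_∈?_)
open import Data.List.Relation.Binary.Disjoint.Propositional using (Disjoint)
open import Data.List.Relation.Unary.All as All using (All; []; _∷_)
import Data.List.Relation.Unary.All.Properties as All
open import Data.List.Relation.Unary.Any using (here; there)
open import Data.List.Relation.Unary.AllPairs as AllPairs using ([]; _∷_)
import Data.List.Relation.Unary.AllPairs.Properties as AllPairs
open import Data.List.Relation.Unary.Unique.Propositional using (Unique)
open import Data.List.Relation.Unary.Unique.Propositional.Properties using (allFin⁺; concat⁺; cartesianProduct⁺; cartesianProductWith⁺; filter⁺)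
import Data.List.Relation.Unary.Unique.DecPropositional as DecUnique
open import Function using (_∘_)
open import Relation.Nullary using (¬_; Dec; yes; no; contradiction)
open import Relation.Nullary.Decidable using (_×-dec_; _⊎-dec_; ¬?)
open import Relation.Unary using (Decidable)
open import Relation.Binary.Definitions using (tri<; tri≈; tri>)
open import Relation.Binary.PropositionalEquality hiding ([_])
open import Relation.Binary.Construct.Closure.ReflexiveTransitive as Star using (Star; _◅_; _◅◅_)

-- The seed orients each arriving edge, so a round is a random ordered pair
-- (u , v) owned by u.  Write r′ = r − 1.  A vertex uses the colours
-- 0, …, r′ − 1 once each on the rounds it owns and colour r′ from then on.
-- Let S be the number, summed over the colours, of ordered pairs
-- joined in that colour.  Components have order at most √S, so it suffices
-- that E S = O(n): by Markov's inequality S ≤ n^(4/3) with high probability,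
-- and components have order at most about n^(2/3).
--
-- In a colour below r′ the vertices that may still receive it lie in distinct
-- components, so a round raises the number of joined pairs by a factor of at most
-- 1 + O(1/n) on average, hence by O(1) over O(n) rounds.
--
-- In colour r′ every joined pair is joined by a simple path, each arc of which
-- is owned by a vertex owning at least r′ ≈ (1 + ε) · average rounds.  An
-- exponential moment bounds the probability of a given path of length k by
-- (λ/n)^k, where λ ≤ 1/4 for large r, and the sum over all paths is O(n).

-- Probabilities are kept as counts: an expectation is a sum over `outcomes T`, and every ratio is
-- cleared of denominators, so a bound on a probability reads as an inequality between two products.
-- Since r is fixed before n grows, the constants may depend on r in any way; the colours below r′
-- use only T ≤ r * n and afford a crude factor 2 ^ (6 * r). The obstacle is the last colour: a
-- vertex may own many of its edges, so able vertices can share a component and the one-round growth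
-- bound breaks down. There the factor 1 - ε and the size of r decide. A path has at most 2n
-- continuations per step (a direction and a vertex). A prescribed arc occurs with probability of
-- order 1/n, with a constant depending on ε only in the tilt chosen here; this cancels the n but
-- leaves a constant factor. The overload of the owner supplies a further factor exponentially small
-- in r, and a large r makes it beat that constant.

^-distribʳ-* : ∀ t a b → (a * b) ^ t ≡ a ^ t * b ^ t
^-distribʳ-* zero    a b = refl
^-distribʳ-* (suc t) a b = trans (cong (a * b *_) (^-distribʳ-* t a b)) (shuffle a b (a ^ t) (b ^ t))
  where
  shuffle : ∀ a b c d → a * b * (c * d) ≡ a * c * (b * d)
  shuffle = solve-∀

-- Finite sums and products over lists

private variable
  α β γ : Set

∑ : List α → (α → ℕ) → ℕ
∑ []       f = 0
∑ (x ∷ xs) f = f x + ∑ xs f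

∏ : List α → (α → ℕ) → ℕ
∏ []       f = 1
∏ (x ∷ xs) f = f x * ∏ xs f

𝟙 : {P : Set} → Dec P → ℕ
𝟙 (yes _) = 1
𝟙 (no _)  = 0

𝟙-mono : {P Q : Set} (p? : Dec P) (q? : Dec Q) → (P → Q) → 𝟙 p? ≤ 𝟙 q?
𝟙-mono (no _)  _       _ = z≤n
𝟙-mono (yes _) (yes _) _ = ≤-refl
𝟙-mono (yes p) (no ¬q) f = contradiction (f p) ¬q

𝟙-yes : {P : Set} (p? : Dec P) → P → 𝟙 p? ≡ 1
𝟙-yes (yes _) _ = refl
𝟙-yes (no ¬p) p = contradiction p ¬p

𝟙-no : {P : Set} (p? : Dec P) → ¬ P → 𝟙 p? ≡ 0
𝟙-no (yes p) ¬p = contradiction p ¬p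
𝟙-no (no _)  _  = refl

𝟙-≤ : {P : Set} (p? : Dec P) {m : ℕ} → (P → 1 ≤ m) → 𝟙 p? ≤ m
𝟙-≤ (yes p) f = f p
𝟙-≤ (no _)  _ = z≤n

𝟙-⊎ : {P Q : Set} (p? : Dec P) (q? : Dec Q) → 𝟙 (p? ⊎-dec q?) ≤ 𝟙 p? + 𝟙 q?
𝟙-⊎ (yes _) _       = s≤s z≤n
𝟙-⊎ (no _)  (yes _) = ≤-refl
𝟙-⊎ (no _)  (no _)  = ≤-refl

𝟙-× : {P Q : Set} (p? : Dec P) (q? : Dec Q) → 𝟙 (p? ×-dec q?) ≡ 𝟙 p? * 𝟙 q?
𝟙-× (yes _) (yes _) = refl
𝟙-× (yes _) (no _)  = refl
𝟙-× (no _)  _       = refl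

∑-mono : (xs : List α) {f g : α → ℕ} → (∀ x → f x ≤ g x) → ∑ xs f ≤ ∑ xs g
∑-mono []       h = z≤n
∑-mono (x ∷ xs) h = +-mono-≤ (h x) (∑-mono xs h)

∑-mono-∈ : (xs : List α) {f g : α → ℕ} → (∀ {x} → x ∈ xs → f x ≤ g x) → ∑ xs f ≤ ∑ xs g
∑-mono-∈ []       h = z≤n
∑-mono-∈ (x ∷ xs) h = +-mono-≤ (h (here refl)) (∑-mono-∈ xs (h ∘ there))

∑-cong : (xs : List α) {f g : α → ℕ} → (∀ x → f x ≡ g x) → ∑ xs f ≡ ∑ xs g
∑-cong []       h = refl
∑-cong (x ∷ xs) h = cong₂ _+_ (h x) (∑-cong xs h)

∑-+ : (xs : List α) (f g : α → ℕ) → ∑ xs (λ x → f x + g x) ≡ ∑ xs f + ∑ xs g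
∑-+ []       f g = refl
∑-+ (x ∷ xs) f g = trans (cong (f x + g x +_) (∑-+ xs f g)) (shuffle (f x) (g x) _ _)
  where
  shuffle : ∀ a b c d → a + b + (c + d) ≡ a + c + (b + d)
  shuffle = solve-∀

∑-*ˡ : (xs : List α) (c : ℕ) (f : α → ℕ) → ∑ xs (λ x → c * f x) ≡ c * ∑ xs f
∑-*ˡ []       c f = sym (*-zeroʳ c)
∑-*ˡ (x ∷ xs) c f = trans (cong (c * f x +_) (∑-*ˡ xs c f)) (sym (*-distribˡ-+ c (f x) _))

∑-*ʳ : (xs : List α) (c : ℕ) (f : α → ℕ) → ∑ xs (λ x → f x * c) ≡ ∑ xs f * c
∑-*ʳ []       c f = refl
∑-*ʳ (x ∷ xs) c f = trans (cong (f x * c +_) (∑-*ʳ xs c f)) (sym (*-distribʳ-+ c (f x) _))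

∑-const : (xs : List α) (c : ℕ) → ∑ xs (λ _ → c) ≡ length xs * c
∑-const []       c = refl
∑-const (x ∷ xs) c = cong (c +_) (∑-const xs c)

∑-zero : (xs : List α) {f : α → ℕ} → (∀ x → f x ≡ 0) → ∑ xs f ≡ 0
∑-zero xs h = trans (∑-cong xs h) (trans (∑-const xs 0) (*-zeroʳ (length xs)))

∑-bound : (xs : List α) (c : ℕ) {f : α → ℕ} → (∀ x → f x ≤ c) → ∑ xs f ≤ length xs * c
∑-bound xs c h = ≤-trans (∑-mono xs h) (≤-reflexive (∑-const xs c))

∑-swap : (xs : List α) (ys : List β) (f : α → β → ℕ) →
         ∑ xs (λ x → ∑ ys (f x)) ≡ ∑ ys (λ y → ∑ xs (λ x → f x y))
∑-swap []       ys f = sym (∑-zero ys (λ _ → refl))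
∑-swap (x ∷ xs) ys f = trans (cong (∑ ys (f x) +_) (∑-swap xs ys f))
                             (sym (∑-+ ys (f x) (λ y → ∑ xs (λ x → f x y))))

∑-++ : (xs ys : List α) (f : α → ℕ) → ∑ (xs ++ ys) f ≡ ∑ xs f + ∑ ys f
∑-++ []       ys f = refl
∑-++ (x ∷ xs) ys f = trans (cong (f x +_) (∑-++ xs ys f)) (sym (+-assoc (f x) _ _))

∑-map : (h : α → β) (xs : List α) (f : β → ℕ) → ∑ (map h xs) f ≡ ∑ xs (f ∘ h)
∑-map h []       f = refl
∑-map h (x ∷ xs) f = cong (f (h x) +_) (∑-map h xs f)

∑-concatMap : (h : α → List β) (xs : List α) (f : β → ℕ) →
              ∑ (concatMap h xs) f ≡ ∑ xs (λ x → ∑ (h x) f)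
∑-concatMap h []       f = refl
∑-concatMap h (x ∷ xs) f = trans (∑-++ (h x) _ f) (cong (∑ (h x) f +_) (∑-concatMap h xs f))

∈⇒≤∑ : {xs : List α} {x : α} (f : α → ℕ) → x ∈ xs → f x ≤ ∑ xs f
∈⇒≤∑ f (here refl) = m≤m+n (f _) _
∈⇒≤∑ f (there x∈)  = ≤-trans (∈⇒≤∑ f x∈) (m≤n+m _ (f _))

length-filter-¬ : {P : α → Set} (P? : Decidable P) (xs : List α) →
                  length (filter P? xs) + ∑ xs (λ x → 𝟙 (¬? (P? x))) ≡ length xs
length-filter-¬ P? []       = refl
length-filter-¬ P? (x ∷ xs) with P? x
... | yes _ = cong suc (length-filter-¬ P? xs)
... | no  _ = trans (+-suc _ _) (cong suc (length-filter-¬ P? xs))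

∑-𝟙-≤1 : {P : α → Set} (P? : Decidable P) {xs : List α} → Unique xs →
         (∀ {x y} → P x → P y → x ≡ y) → ∑ xs (λ x → 𝟙 (P? x)) ≤ 1
∑-𝟙-≤1 P? []                     inj = z≤n
∑-𝟙-≤1 P? {x ∷ xs} (x∉xs ∷ xs!) inj with P? x
... | no _   = ∑-𝟙-≤1 P? xs! inj
... | yes Px = ≤-reflexive (cong suc (n≤0⇒n≡0 (≤-trans
  (∑-mono-∈ xs (λ {y} y∈ → ≤-reflexive (𝟙-no (P? y) (λ Py → All.lookup x∉xs y∈ (inj Px Py)))))
  (≤-reflexive (∑-zero xs {λ _ → 0} (λ _ → refl))))))

∏-* : (xs : List α) (f g : α → ℕ) → ∏ xs (λ x → f x * g x) ≡ ∏ xs f * ∏ xs g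
∏-* []       f g = refl
∏-* (x ∷ xs) f g = trans (cong (f x * g x *_) (∏-* xs f g)) (shuffle (f x) (g x) _ _)
  where
  shuffle : ∀ a b c d → a * b * (c * d) ≡ a * c * (b * d)
  shuffle = solve-∀

-- Exponential Markov inequality for a 0/1-valued statistic c.
∏-lower : (xs : List α) (c : α → ℕ) (lo gap m : ℕ) → (∀ x → c x ≤ 1) → m ≤ ∑ xs c →
          (lo + gap) ^ m * lo ^ length xs ≤ lo ^ m * ∏ xs (λ x → lo + gap * c x)
∏-lower []       c lo gap zero    c≤1 _ = ≤-refl
∏-lower (x ∷ xs) c lo gap m       c≤1 m≤ with c x in eq | c≤1 x
∏-lower (x ∷ xs) c lo gap m       c≤1 m≤ | zero | _ = begin
  (lo + gap) ^ m * (lo * lo ^ length xs)      ≡⟨ swap₁ ((lo + gap) ^ m) lo (lo ^ length xs) ⟩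
  lo * ((lo + gap) ^ m * lo ^ length xs)      ≤⟨ *-monoʳ-≤ lo (∏-lower xs c lo gap m c≤1 m≤) ⟩
  lo * (lo ^ m * ∏ xs (λ x → lo + gap * c x)) ≡⟨ swap₂ lo (lo ^ m) (∏ xs (λ x → lo + gap * c x)) gap ⟩
  lo ^ m * ((lo + gap * 0) * ∏ xs (λ x → lo + gap * c x)) ∎
  where
  open ≤-Reasoning
  swap₁ : ∀ a b d → a * (b * d) ≡ b * (a * d)
  swap₁ = solve-∀
  swap₂ : ∀ b a d g → b * (a * d) ≡ a * ((b + g * 0) * d)
  swap₂ = solve-∀
∏-lower (x ∷ xs) c lo gap zero    c≤1 m≤ | suc zero | _ = begin
  1 * (lo * lo ^ length xs)                   ≡⟨ swap₁ lo _ ⟩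
  lo * (1 * lo ^ length xs)                   ≤⟨ *-mono-≤ (m≤m+n lo (gap * 1)) (∏-lower xs c lo gap 0 c≤1 z≤n) ⟩
  (lo + gap * 1) * (1 * ∏ xs (λ x → lo + gap * c x)) ≡⟨ sym (swap₁ (lo + gap * 1) _) ⟩
  1 * ((lo + gap * 1) * ∏ xs (λ x → lo + gap * c x)) ∎
  where
  open ≤-Reasoning
  swap₁ : ∀ a b → 1 * (a * b) ≡ a * (1 * b)
  swap₁ = solve-∀
∏-lower (x ∷ xs) c lo gap (suc m) c≤1 (s≤s m≤) | suc zero | _ = begin
  (lo + gap) * (lo + gap) ^ m * (lo * lo ^ length xs) ≡⟨ swap₁ lo gap ((lo + gap) ^ m) (lo ^ length xs) ⟩
  (lo + gap) * lo * ((lo + gap) ^ m * lo ^ length xs) ≤⟨ *-monoʳ-≤ ((lo + gap) * lo) (∏-lower xs c lo gap m c≤1 m≤) ⟩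
  (lo + gap) * lo * (lo ^ m * ∏ xs (λ x → lo + gap * c x)) ≡⟨ swap₂ lo gap (lo ^ m) (∏ xs (λ x → lo + gap * c x)) ⟩
  lo * lo ^ m * ((lo + gap * 1) * ∏ xs (λ x → lo + gap * c x)) ∎
  where
  open ≤-Reasoning
  swap₁ : ∀ l g a d → (l + g) * a * (l * d) ≡ (l + g) * l * (a * d)
  swap₁ = solve-∀
  swap₂ : ∀ l g a d → (l + g) * l * (a * d) ≡ l * a * ((l + g * 1) * d)
  swap₂ = solve-∀
∏-lower (x ∷ xs) c lo gap m c≤1 m≤ | suc (suc _) | s≤s ()

-- Sums over the vertex set

module Vertices (n : ℕ) where

  abstract
    vertices : List (Fin n)
    vertices = allFin n

    length-vertices : length vertices ≡ n
    length-vertices = length-tabulate (λ i → i)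

    vertices-unique : Unique vertices
    vertices-unique = allFin⁺ n

    ∈-vertices : ∀ u → u ∈ vertices
    ∈-vertices = Memb.∈-allFin

  ∑-vertices-1 : ∑ vertices (λ _ → 1) ≡ n
  ∑-vertices-1 = trans (∑-const vertices 1) (trans (*-identityʳ _) length-vertices)

  ∑-≟ : (a : Fin n) → ∑ vertices (λ u → 𝟙 (a Fin.≟ u)) ≡ 1
  ∑-≟ a = ≤-antisym
    (∑-𝟙-≤1 (a Fin.≟_) vertices-unique (λ p q → trans (sym p) q))
    (≤-trans (≤-reflexive (sym (𝟙-yes (a Fin.≟ a) refl)))
             (∈⇒≤∑ (λ u → 𝟙 (a Fin.≟ u)) (∈-vertices a)))

  occurrences : List (Fin n) → Fin n → ℕ
  occurrences xs u = ∑ xs (λ x → 𝟙 (x Fin.≟ u))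

  ∑-occurrences : (xs : List (Fin n)) → ∑ vertices (occurrences xs) ≡ length xs
  ∑-occurrences xs = begin
    ∑ vertices (λ u → ∑ xs (λ x → 𝟙 (x Fin.≟ u))) ≡⟨ ∑-swap vertices xs _ ⟩
    ∑ xs (λ x → ∑ vertices (λ u → 𝟙 (x Fin.≟ u))) ≡⟨ ∑-cong xs ∑-≟ ⟩
    ∑ xs (λ _ → 1)                                ≡⟨ ∑-const xs 1 ⟩
    length xs * 1                                 ≡⟨ *-identityʳ _ ⟩
    length xs                                     ∎
    where open ≡-Reasoning

  occurrences-≤1 : {xs : List (Fin n)} → Unique xs → ∀ u → occurrences xs u ≤ 1
  occurrences-≤1 xs! u = ∑-𝟙-≤1 (Fin._≟ u) xs! (λ p q → trans p (sym q))

  ∑-unique≤∑-vertices : {xs : List (Fin n)} → Unique xs → (f : Fin n → ℕ) → ∑ xs f ≤ ∑ vertices f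
  ∑-unique≤∑-vertices {xs} xs! f = begin
    ∑ xs f                                                    ≡⟨ ∑-cong xs (λ x → sym (pick x)) ⟩
    ∑ xs (λ x → ∑ vertices (λ u → 𝟙 (x Fin.≟ u) * f u))       ≡⟨ ∑-swap xs vertices _ ⟩
    ∑ vertices (λ u → ∑ xs (λ x → 𝟙 (x Fin.≟ u) * f u))       ≡⟨ ∑-cong vertices (λ u → ∑-*ʳ xs (f u) _) ⟩
    ∑ vertices (λ u → occurrences xs u * f u)                 ≤⟨ ∑-mono vertices (λ u → *-monoˡ-≤ (f u) (occurrences-≤1 xs! u)) ⟩
    ∑ vertices (λ u → 1 * f u)                                ≡⟨ ∑-cong vertices (λ u → *-identityˡ (f u)) ⟩
    ∑ vertices f                                              ∎
    where
    open ≤-Reasoning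
    pick : ∀ x → ∑ vertices (λ u → 𝟙 (x Fin.≟ u) * f u) ≡ f x
    pick x = trans (∑-cong vertices same) (trans (∑-*ʳ vertices (f x) _) (trans (cong (_* f x) (∑-≟ x)) (*-identityˡ (f x))))
      where
      same : ∀ u → 𝟙 (x Fin.≟ u) * f u ≡ 𝟙 (x Fin.≟ u) * f x
      same u with x Fin.≟ u
      ... | yes refl = refl
      ... | no _     = refl

-- Rounds as ordered pairs of vertices, and sums over outcomes

∑-cartesianProductWith : (h : α → β → γ) (xs : List α) (ys : List β) (f : γ → ℕ) →
  ∑ (cartesianProductWith h xs ys) f ≡ ∑ xs (λ x → ∑ ys (λ y → f (h x y)))
∑-cartesianProductWith h []       ys f = refl
∑-cartesianProductWith h (x ∷ xs) ys f = trans (∑-++ (map (h x) ys) _ f)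
  (cong₂ _+_ (∑-map (h x) ys f) (∑-cartesianProductWith h xs ys f))

nC2*2≡n*[n-1] : ∀ m → (suc m C 2) * 2 ≡ suc m * m
nC2*2≡n*[n-1] zero    = refl
nC2*2≡n*[n-1] (suc m) = begin
  (suc (suc m) C 2) * 2             ≡⟨ cong (_* 2) (sym (nCk+nC[k+1]≡[n+1]C[k+1] (suc m) 1)) ⟩
  (suc m C 1 + suc m C 2) * 2       ≡⟨ *-distribʳ-+ 2 (suc m C 1) _ ⟩
  (suc m C 1) * 2 + (suc m C 2) * 2 ≡⟨ cong₂ _+_ (cong (_* 2) (nC1≡n (suc m))) (nC2*2≡n*[n-1] m) ⟩
  suc m * 2 + suc m * m             ≡⟨ arith m ⟩
  suc (suc m) * suc m               ∎
  where
  open ≡-Reasoning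
  arith : ∀ m → suc m * 2 + suc m * m ≡ suc (suc m) * suc m
  arith = solve-∀

Round : ℕ → Set
Round n = Edge n × Fin 2

module _ {n : ℕ} where

  owner target : Round n → Fin n
  owner  (e , Fin.zero)  = Edge.u e
  owner  (e , Fin.suc _) = Edge.v e
  target (e , Fin.zero)  = Edge.v e
  target (e , Fin.suc _) = Edge.u e

  -- Rounds correspond to ordered pairs of distinct vertices: an edge stores its smaller end first,
  -- so the seed alone tells the direction. Hence one element off the diagonal and none on it.
  arcs : Fin n → Fin n → List (Round n)
  arcs u v with Fin.<-cmp u v
  ... | tri< u<v _ _ = [ edge u v u<v , Fin.zero ]
  ... | tri≈ _ _ _   = []
  ... | tri> _ _ v<u = [ edge v u v<u , Fin.suc Fin.zero ]

  arcs-unique : ∀ u v → Unique (arcs u v)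
  arcs-unique u v with Fin.<-cmp u v
  ... | tri< _ _ _ = [] ∷ []
  ... | tri≈ _ _ _ = []
  ... | tri> _ _ _ = [] ∷ []

  ∈-arcs : ∀ u v {e} → e ∈ arcs u v → (owner e , target e) ≡ (u , v)
  ∈-arcs u v e∈ with Fin.<-cmp u v
  ∈-arcs u v (here refl) | tri< _ _ _ = refl
  ∈-arcs u v (here refl) | tri> _ _ _ = refl
  ∈-arcs u v ()          | tri≈ _ _ _

  arcs-disjoint : ∀ {p q} → p ≢ q → Disjoint (uncurry arcs p) (uncurry arcs q)
  arcs-disjoint {u , v} {u′ , v′} p≢q (e∈ , e∈′) = p≢q (trans (sym (∈-arcs u v e∈)) (∈-arcs u′ v′ e∈′))

  ∑-arcs-≤ : (G : Fin n → Fin n → ℕ) → ∀ u v → ∑ (arcs u v) (λ e → G (owner e) (target e)) ≤ G u v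
  ∑-arcs-≤ G u v with Fin.<-cmp u v
  ... | tri< _ _ _ = ≤-reflexive (+-identityʳ _)
  ... | tri≈ _ _ _ = z≤n
  ... | tri> _ _ _ = ≤-reflexive (+-identityʳ _)

  ∑-arcs-owner : (g : Fin n → ℕ) → ∀ u v → ∑ (arcs u v) (g ∘ owner) + 𝟙 (u Fin.≟ v) * g u ≡ g u
  ∑-arcs-owner g u v with Fin.<-cmp u v | u Fin.≟ v
  ... | tri< _ u≢v _ | yes u≡v = contradiction u≡v u≢v
  ... | tri< _ _ _   | no _    = trans (+-identityʳ _) (+-identityʳ _)
  ... | tri≈ _ _ _   | yes _   = +-identityʳ _
  ... | tri≈ _ u≡v _ | no u≢v  = contradiction u≡v u≢v
  ... | tri> _ u≢v _ | yes u≡v = contradiction u≡v u≢v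
  ... | tri> _ _ _   | no _    = trans (+-identityʳ _) (+-identityʳ _)

  load : List (Round n) → Fin n → ℕ
  load h u = ∑ h (λ e → 𝟙 (u Fin.≟ owner e))

module Rounds (n : ℕ) where

  open Vertices n

  abstract
    allRounds : List (Round n)
    allRounds = concatMap (uncurry arcs) (cartesianProduct vertices vertices)

    allRounds-unique : Unique allRounds
    allRounds-unique = concat⁺
      (All.map⁺ (All.tabulate (λ {(u , v)} _ → arcs-unique u v)))
      (AllPairs.map⁺ (AllPairs.map arcs-disjoint (cartesianProduct⁺ vertices-unique vertices-unique)))

    ∑-allRounds : (F : Round n → ℕ) →
                  ∑ allRounds F ≡ ∑ vertices (λ u → ∑ vertices (λ v → ∑ (arcs u v) F))
    ∑-allRounds F = trans (∑-concatMap (uncurry arcs) (cartesianProduct vertices vertices) F)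
                          (∑-cartesianProductWith _,_ vertices vertices _)

  ∑-allRounds-≤ : (G : Fin n → Fin n → ℕ) →
    ∑ allRounds (λ e → G (owner e) (target e)) ≤ ∑ vertices (λ u → ∑ vertices (G u))
  ∑-allRounds-≤ G = ≤-trans (≤-reflexive (∑-allRounds _))
    (∑-mono vertices (λ u → ∑-mono vertices (∑-arcs-≤ G u)))

  -- Each vertex owns n - 1 rounds. The missing diagonal pair is added on the left to avoid a
  -- subtraction; it is cancelled once n is a successor.
  ∑-allRounds-owner : (g : Fin n → ℕ) → ∑ allRounds (g ∘ owner) + ∑ vertices g ≡ n * ∑ vertices g
  ∑-allRounds-owner g = begin
    ∑ allRounds (g ∘ owner) + ∑ vertices g
      ≡⟨ cong₂ _+_ (∑-allRounds (g ∘ owner)) (∑-cong vertices (λ u → sym (row u))) ⟩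
    ∑ vertices (λ u → ∑ vertices (λ v → ∑ (arcs u v) (g ∘ owner))) + ∑ vertices (λ u → ∑ vertices (λ v → 𝟙 (u Fin.≟ v) * g u))
      ≡⟨ sym (∑-+ vertices _ _) ⟩
    ∑ vertices (λ u → ∑ vertices (λ v → ∑ (arcs u v) (g ∘ owner)) + ∑ vertices (λ v → 𝟙 (u Fin.≟ v) * g u))
      ≡⟨ ∑-cong vertices (λ u → sym (∑-+ vertices _ _)) ⟩
    ∑ vertices (λ u → ∑ vertices (λ v → ∑ (arcs u v) (g ∘ owner) + 𝟙 (u Fin.≟ v) * g u))
      ≡⟨ ∑-cong vertices (λ u → ∑-cong vertices (∑-arcs-owner g u)) ⟩
    ∑ vertices (λ u → ∑ vertices (λ v → g u))
      ≡⟨ ∑-cong vertices (λ u → trans (∑-const vertices (g u)) (cong (_* g u) length-vertices)) ⟩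
    ∑ vertices (λ u → n * g u)
      ≡⟨ ∑-*ˡ vertices n g ⟩
    n * ∑ vertices g ∎
    where
    open ≡-Reasoning
    row : ∀ u → ∑ vertices (λ v → 𝟙 (u Fin.≟ v) * g u) ≡ g u
    row u = trans (∑-*ʳ vertices (g u) _) (trans (cong (_* g u) (∑-≟ u)) (*-identityˡ (g u)))

  outcomes : (T : ℕ) → List (Vec (Round n) T)
  outcomes zero    = [ [] ]
  outcomes (suc T) = cartesianProductWith _∷_ allRounds (outcomes T)

  outcomes-unique : ∀ T → Unique (outcomes T)
  outcomes-unique zero    = [] ∷ []
  outcomes-unique (suc T) = cartesianProductWith⁺ _∷_ Vec.∷-injective allRounds-unique (outcomes-unique T)

  history : ∀ {T} → Vec (Round n) T → List (Round n)
  history ω = toList ω ʳ++ []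

  length-history : ∀ {T} (ω : Vec (Round n) T) (h : List (Round n)) → length (toList ω ʳ++ h) ≡ T + length h
  length-history []      h = refl
  length-history (e ∷ ω) h = trans (length-history ω (e ∷ h)) (+-suc _ (length h))

  -- Induction on the number of rounds, summing over the earliest one. It serves two potentials: the
  -- joined pairs of a colour and the tilted weight of a path. The constant `a` is the number of
  -- rounds times the mean growth factor in one round.
  supermartingale : (Φ : List (Round n) → ℕ) (a : ℕ) →
    (∀ h → ∑ allRounds (λ e → Φ (e ∷ h)) ≤ a * Φ h) →
    ∀ T h → ∑ (outcomes T) (λ ω → Φ (toList ω ʳ++ h)) ≤ a ^ T * Φ h
  supermartingale Φ a step zero    h = ≤-refl
  supermartingale Φ a step (suc T) h = begin
    ∑ (outcomes (suc T)) (λ ω → Φ (toList ω ʳ++ h))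
      ≡⟨ ∑-cartesianProductWith _∷_ allRounds (outcomes T) _ ⟩
    ∑ allRounds (λ e → ∑ (outcomes T) (λ ω → Φ (toList ω ʳ++ (e ∷ h))))
      ≤⟨ ∑-mono allRounds (λ e → supermartingale Φ a step T (e ∷ h)) ⟩
    ∑ allRounds (λ e → a ^ T * Φ (e ∷ h))
      ≡⟨ ∑-*ˡ allRounds (a ^ T) _ ⟩
    a ^ T * ∑ allRounds (λ e → Φ (e ∷ h))
      ≤⟨ *-monoʳ-≤ (a ^ T) (step h) ⟩
    a ^ T * (a * Φ h)
      ≡⟨ sym (*-assoc (a ^ T) a (Φ h)) ⟩
    a ^ T * a * Φ h
      ≡⟨ cong (_* Φ h) (*-comm (a ^ T) a) ⟩
    a * a ^ T * Φ h ∎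
    where open ≤-Reasoning

module PositiveRounds (m : ℕ) where

  open Vertices (suc m)
  open Rounds (suc m)

  ∑-owner : (g : Fin (suc m) → ℕ) → ∑ allRounds (g ∘ owner) ≡ m * ∑ vertices g
  ∑-owner g = +-cancelʳ-≡ (∑ vertices g) _ _ (trans (∑-allRounds-owner g) (+-comm (∑ vertices g) _))

  length-allRounds : length allRounds ≡ suc m * m
  length-allRounds = begin
    length allRounds         ≡⟨ sym (*-identityʳ _) ⟩
    length allRounds * 1     ≡⟨ sym (∑-const allRounds 1) ⟩
    ∑ allRounds (λ _ → 1)    ≡⟨ ∑-owner (λ _ → 1) ⟩
    m * ∑ (vertices) (λ _ → 1) ≡⟨ cong (m *_) (∑-vertices-1) ⟩
    m * suc m                          ≡⟨ *-comm m (suc m) ⟩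
    suc m * m                          ∎
    where open ≡-Reasoning

  length-outcomes : ∀ T → length (outcomes T) ≡ (suc m * m) ^ T
  length-outcomes zero    = refl
  length-outcomes (suc T) = begin
    length (outcomes (suc T))                   ≡⟨ sym (trans (∑-const (outcomes (suc T)) 1) (*-identityʳ _)) ⟩
    ∑ (outcomes (suc T)) (λ _ → 1)              ≡⟨ ∑-cartesianProductWith _∷_ allRounds (outcomes T) _ ⟩
    ∑ allRounds (λ _ → ∑ (outcomes T) (λ _ → 1)) ≡⟨ ∑-const allRounds _ ⟩
    length allRounds * ∑ (outcomes T) (λ _ → 1)
      ≡⟨ cong₂ _*_ length-allRounds (trans (∑-const (outcomes T) 1) (*-identityʳ _)) ⟩
    suc m * m * length (outcomes T)             ≡⟨ cong (suc m * m *_) (length-outcomes T) ⟩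
    (suc m * m) ^ suc T ∎
    where open ≡-Reasoning

-- The algorithm

slot : ∀ {n} → ℕ → List (Round n) → Fin n → ℕ
slot r′ h u = load h u ⊓ r′

slot<r : ∀ {n} r′ (h : List (Round n)) u → slot r′ h u < suc r′
slot<r r′ h u = s≤s (m⊓n≤n (load h u) r′)

algorithm : ∀ n r′ → OnlineAlgorithm n (suc r′)
-- The seed is drawn from `Fin (suc seeds)`, so this is a fair coin.
algorithm n r′ .seeds        = 1
algorithm n r′ .colour h e s = fromℕ< (slot<r r′ h (owner (e , s)))

-- Components of a colour and their growth in one round

module Components (n r′ : ℕ) where

  open Vertices n
  open Rounds n

  -- Histories list the most recent round first.
  Conn : ℕ → List (Round n) → Fin n → Fin n → Set
  Conn c []      x y = x ≡ y
  Conn c (e ∷ h) x y = Conn c h x y ⊎ (slot r′ h (owner e) ≡ c ×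
    (Conn c h x (owner e) × Conn c h (target e) y ⊎ Conn c h x (target e) × Conn c h (owner e) y))

  Conn? : ∀ c h x y → Dec (Conn c h x y)
  Conn? c []      x y = x Fin.≟ y
  Conn? c (e ∷ h) x y = Conn? c h x y ⊎-dec (slot r′ h (owner e) ≟ c ×-dec
    (Conn? c h x (owner e) ×-dec Conn? c h (target e) y ⊎-dec Conn? c h x (target e) ×-dec Conn? c h (owner e) y))

  Conn-refl : ∀ c h {x} → Conn c h x x
  Conn-refl c []      = refl
  Conn-refl c (e ∷ h) = inj₁ (Conn-refl c h)

  Conn-sym : ∀ c h {x y} → Conn c h x y → Conn c h y x
  Conn-sym c []      p = sym p
  Conn-sym c (e ∷ h) (inj₁ p)                    = inj₁ (Conn-sym c h p)
  Conn-sym c (e ∷ h) (inj₂ (k , inj₁ (p , q)))   = inj₂ (k , inj₂ (Conn-sym c h q , Conn-sym c h p))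
  Conn-sym c (e ∷ h) (inj₂ (k , inj₂ (p , q)))   = inj₂ (k , inj₁ (Conn-sym c h q , Conn-sym c h p))

  -- `Conn` performs one union per round instead of taking a closure, which makes it decidable by
  -- recursion. Transitivity then has to merge two crossings of the newest edge: in the same
  -- direction they become one crossing, in opposite directions they cancel.
  Conn-trans : ∀ c h {x y z} → Conn c h x y → Conn c h y z → Conn c h x z
  Conn-trans c []      p q = trans p q
  Conn-trans c (e ∷ h) (inj₁ p) (inj₁ q) = inj₁ (Conn-trans c h p q)
  Conn-trans c (e ∷ h) (inj₁ p) (inj₂ (k , inj₁ (q , q′))) = inj₂ (k , inj₁ (Conn-trans c h p q , q′))
  Conn-trans c (e ∷ h) (inj₁ p) (inj₂ (k , inj₂ (q , q′))) = inj₂ (k , inj₂ (Conn-trans c h p q , q′))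
  Conn-trans c (e ∷ h) (inj₂ (k , inj₁ (p , p′))) (inj₁ q) = inj₂ (k , inj₁ (p , Conn-trans c h p′ q))
  Conn-trans c (e ∷ h) (inj₂ (k , inj₂ (p , p′))) (inj₁ q) = inj₂ (k , inj₂ (p , Conn-trans c h p′ q))
  Conn-trans c (e ∷ h) (inj₂ (k , inj₁ (p , p′))) (inj₂ (_ , inj₁ (q , q′))) = inj₂ (k , inj₁ (p , q′))
  Conn-trans c (e ∷ h) (inj₂ (k , inj₁ (p , p′))) (inj₂ (_ , inj₂ (q , q′))) = inj₁ (Conn-trans c h p q′)
  Conn-trans c (e ∷ h) (inj₂ (k , inj₂ (p , p′))) (inj₂ (_ , inj₁ (q , q′))) = inj₁ (Conn-trans c h p q′)
  Conn-trans c (e ∷ h) (inj₂ (k , inj₂ (p , p′))) (inj₂ (_ , inj₂ (q , q′))) = inj₂ (k , inj₂ (p , q′))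

  Conn-later : ∀ c (es h : List (Round n)) {x y} → Conn c h x y → Conn c (es ʳ++ h) x y
  Conn-later c []       h p = p
  Conn-later c (e ∷ es) h p = Conn-later c es (e ∷ h) (inj₁ p)

  load-∷ʳ : ∀ (h : List (Round n)) e {h′} → (∀ u → load h u ≡ load h′ u) → ∀ u → load (h ++ [ e ]) u ≡ load (e ∷ h′) u
  load-∷ʳ h e eq u = trans (∑-++ h [ e ] _) (trans (cong₂ _+_ (eq u) (+-identityʳ _)) (+-comm _ (𝟙 (u Fin.≟ owner e))))

  -- The run appends to its history, whereas `Conn` reads the newest round first. A colour depends
  -- on the history only through loads, so the induction carries two histories with equal loads.
  edge⇒Conn : ∀ (h es h′ : List (Round n)) → (∀ u → load h u ≡ load h′ u) → ∀ {e c} →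
              (e , c) ∈ runFrom (algorithm n r′) h es → Conn (toℕ c) (es ʳ++ h′) (Edge.u e) (Edge.v e)
  edge⇒Conn h ((e , s) ∷ es) h′ eq (there p) = edge⇒Conn (h ++ [ e , s ]) es ((e , s) ∷ h′) (load-∷ʳ h (e , s) {h′} eq) p
  edge⇒Conn h ((e , s) ∷ es) h′ eq (here refl) = Conn-later _ es ((e , s) ∷ h′) (inj₂ (colour-eq , joined s))
    where
    c = toℕ (fromℕ< (slot<r r′ h (owner (e , s))))
    colour-eq : slot r′ h′ (owner (e , s)) ≡ c
    colour-eq = trans (cong (_⊓ r′) (sym (eq (owner (e , s))))) (sym (Fin.toℕ-fromℕ< _))
    joined : ∀ s → Conn c h′ (Edge.u e) (owner (e , s)) × Conn c h′ (target (e , s)) (Edge.v e)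
                 ⊎ Conn c h′ (Edge.u e) (target (e , s)) × Conn c h′ (owner (e , s)) (Edge.v e)
    joined Fin.zero    = inj₁ (Conn-refl c h′ , Conn-refl c h′)
    joined (Fin.suc _) = inj₂ (Conn-refl c h′ , Conn-refl c h′)

  connected⇒Conn : ∀ {T} (ω : Vec (Round n) T) c {x y} →
                   Connected (run (algorithm n r′) ω) c x y → Conn (toℕ c) (history ω) x y
  connected⇒Conn ω c Star.ε = Conn-refl _ (history ω)
  connected⇒Conn ω c ((e , e∈ , inj₁ (refl , refl)) ◅ p) =
    Conn-trans _ (history ω) (edge⇒Conn [] (toList ω) [] (λ _ → refl) e∈) (connected⇒Conn ω c p)
  connected⇒Conn ω c ((e , e∈ , inj₂ (refl , refl)) ◅ p) =
    Conn-trans _ (history ω) (Conn-sym _ (history ω) (edge⇒Conn [] (toList ω) [] (λ _ → refl) e∈)) (connected⇒Conn ω c p)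

  size : ℕ → List (Round n) → Fin n → ℕ
  size c h x = ∑ vertices (λ y → 𝟙 (Conn? c h x y))

  -- Equivalently Σ |C|² over the components C of colour c.
  pairs : ℕ → List (Round n) → ℕ
  pairs c h = ∑ vertices (size c h)

  totalPairs : List (Round n) → ℕ
  totalPairs h = ∑ (upTo (suc r′)) (λ c → pairs c h)

  -- Each member of `ys` is joined to all of `ys`, so its `size` is at least `length ys`; summing
  -- over the members gives the square.
  component²≤pairs : ∀ c h x {ys} → Unique ys → All (Conn c h x) ys → length ys * length ys ≤ pairs c h
  component²≤pairs c h x {ys} ys! conn = begin
    length ys * length ys         ≡⟨ sym (∑-const ys (length ys)) ⟩
    ∑ ys (λ _ → length ys)        ≤⟨ ∑-mono-∈ ys large ⟩
    ∑ ys (size c h)               ≤⟨ ∑-unique≤∑-vertices ys! (size c h) ⟩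
    pairs c h                     ∎
    where
    open ≤-Reasoning
    large : ∀ {y} → y ∈ ys → length ys ≤ size c h y
    large {y} y∈ = begin
      length ys                          ≡⟨ sym (trans (∑-const ys 1) (*-identityʳ _)) ⟩
      ∑ ys (λ _ → 1)                     ≤⟨ ∑-mono-∈ ys (λ {z} z∈ → ≤-reflexive (sym (𝟙-yes (Conn? c h y z)
                                             (Conn-trans c h (Conn-sym c h (All.lookup conn y∈)) (All.lookup conn z∈))))) ⟩
      ∑ ys (λ z → 𝟙 (Conn? c h y z))     ≤⟨ ∑-unique≤∑-vertices ys! _ ⟩
      size c h y                         ∎

  pairs-[] : ∀ c → pairs c [] ≡ n
  pairs-[] c = trans (∑-cong vertices ∑-≟) (∑-vertices-1)

  size-sym : ∀ c h x → ∑ vertices (λ y → 𝟙 (Conn? c h y x)) ≡ size c h x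
  size-sym c h x = ∑-cong vertices (λ y → ≤-antisym (𝟙-mono (Conn? c h y x) (Conn? c h x y) (Conn-sym c h))
                                                    (𝟙-mono (Conn? c h x y) (Conn? c h y x) (Conn-sym c h)))

  private
    rectangle : ∀ c h u v → ∑ vertices (λ x → ∑ vertices (λ y → 𝟙 (Conn? c h x u ×-dec Conn? c h v y))) ≡ size c h u * size c h v
    rectangle c h u v = begin
      ∑ vertices (λ x → ∑ vertices (λ y → 𝟙 (Conn? c h x u ×-dec Conn? c h v y)))
        ≡⟨ ∑-cong vertices (λ x → ∑-cong vertices (λ y → 𝟙-× (Conn? c h x u) (Conn? c h v y))) ⟩
      ∑ vertices (λ x → ∑ vertices (λ y → 𝟙 (Conn? c h x u) * 𝟙 (Conn? c h v y)))
        ≡⟨ ∑-cong vertices (λ x → ∑-*ˡ vertices (𝟙 (Conn? c h x u)) _) ⟩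
      ∑ vertices (λ x → 𝟙 (Conn? c h x u) * size c h v)
        ≡⟨ ∑-*ʳ vertices (size c h v) _ ⟩
      ∑ vertices (λ x → 𝟙 (Conn? c h x u)) * size c h v
        ≡⟨ cong (_* size c h v) (size-sym c h u) ⟩
      size c h u * size c h v ∎
      where open ≡-Reasoning

  -- A new pair has one vertex in the component of the owner and the other in that of the target;
  -- the factor 2 counts both orders. If the two components coincide this merely overcounts.
  pairs-∷ : ∀ c e h → pairs c (e ∷ h) ≤
            pairs c h + 2 * (𝟙 (slot r′ h (owner e) ≟ c) * size c h (owner e) * size c h (target e))
  pairs-∷ c e h = begin
    pairs c (e ∷ h)
      ≤⟨ ∑-mono vertices (λ x → ∑-mono vertices (λ y → split x y)) ⟩
    ∑ vertices (λ x → ∑ vertices (λ y → 𝟙 (Conn? c h x y) + k * (R u v x y + R v u x y)))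
      ≡⟨ ∑-cong vertices (λ x → ∑-+ vertices _ _) ⟩
    ∑ vertices (λ x → size c h x + ∑ vertices (λ y → k * (R u v x y + R v u x y)))
      ≡⟨ ∑-+ vertices _ _ ⟩
    pairs c h + ∑ vertices (λ x → ∑ vertices (λ y → k * (R u v x y + R v u x y)))
      ≡⟨ cong (pairs c h +_) (trans (∑-cong vertices (λ x → ∑-*ˡ vertices k _)) (∑-*ˡ vertices k _)) ⟩
    pairs c h + k * ∑ vertices (λ x → ∑ vertices (λ y → R u v x y + R v u x y))
      ≡⟨ cong (λ s → pairs c h + k * s) (trans (∑-cong vertices (λ x → ∑-+ vertices _ _)) (∑-+ vertices _ _)) ⟩
    pairs c h + k * (∑ vertices (λ x → ∑ vertices (R u v x)) + ∑ vertices (λ x → ∑ vertices (R v u x)))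
      ≡⟨ cong₂ (λ a b → pairs c h + k * (a + b)) (rectangle c h u v) (rectangle c h v u) ⟩
    pairs c h + k * (size c h u * size c h v + size c h v * size c h u)
      ≡⟨ arith (pairs c h) k (size c h u) (size c h v) ⟩
    pairs c h + 2 * (k * size c h u * size c h v) ∎
    where
    open ≤-Reasoning
    u = owner e
    v = target e
    k = 𝟙 (slot r′ h u ≟ c)
    R : Fin n → Fin n → Fin n → Fin n → ℕ
    R u v x y = 𝟙 (Conn? c h x u ×-dec Conn? c h v y)
    split : ∀ x y → 𝟙 (Conn? c (e ∷ h) x y) ≤ 𝟙 (Conn? c h x y) + k * (R u v x y + R v u x y)
    split x y = ≤-trans (𝟙-⊎ (Conn? c h x y) _) (+-monoʳ-≤ (𝟙 (Conn? c h x y))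
      (≤-trans (≤-reflexive (𝟙-× (slot r′ h u ≟ c) _)) (*-monoʳ-≤ k (𝟙-⊎ (Conn? c h x u ×-dec Conn? c h v y) _))))
    arith : ∀ p k a b → p + k * (a * b + b * a) ≡ p + 2 * (k * a * b)
    arith = solve-∀

  load-owner : ∀ e (h : List (Round n)) → load (e ∷ h) (owner e) ≡ suc (load h (owner e))
  load-owner e h = cong (_+ load h (owner e)) (𝟙-yes (owner e Fin.≟ owner e) refl)

  load-≤-∷ : ∀ e (h : List (Round n)) u → load h u ≤ load (e ∷ h) u
  load-≤-∷ e h u = m≤n+m (load h u) _

  -- A component of colour c keeps at most one vertex that has not yet spent c. A round of colour c
  -- is owned by such a vertex, the only one in its component, and spends it; after the union only
  -- the one on the side of the target can remain. The bound c < r′ ensures that a vertex spends c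
  -- once, at load exactly c.
  root-unique : ∀ {c} → c < r′ → ∀ h {x y} → load h x ≤ c → load h y ≤ c → Conn c h x y → x ≡ y
  root-unique c<r′ []      lx ly x≡y = x≡y
  root-unique c<r′ (e ∷ h) lx ly (inj₁ p) =
    root-unique c<r′ h (≤-trans (load-≤-∷ e h _) lx) (≤-trans (load-≤-∷ e h _) ly) p
  root-unique {c} c<r′ (e ∷ h) {x} {y} lx ly (inj₂ (k , p)) = ⊥-elim (joined p)
    where
    load-u : load h (owner e) ≡ c
    load-u with ⊓-sel (load h (owner e)) r′
    ... | inj₁ s = trans (sym s) k
    ... | inj₂ s = contradiction (trans (sym k) s) (<⇒≢ c<r′)
    saturated : ∀ {z} → load (e ∷ h) z ≤ c → ¬ Conn c h z (owner e)
    saturated {z} lz q with root-unique c<r′ h (≤-trans (load-≤-∷ e h z) lz) (≤-reflexive load-u) q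
    ... | refl = <-irrefl refl (≤-trans (≤-reflexive (sym (trans (load-owner e h) (cong suc load-u)))) lz)
    joined : ¬ (Conn c h x (owner e) × Conn c h (target e) y ⊎ Conn c h x (target e) × Conn c h (owner e) y)
    joined (inj₁ (q , _)) = saturated lx q
    joined (inj₂ (_ , q)) = saturated ly (Conn-sym c h q)

  -- The vertices able to receive colour c lie in distinct components, so
  -- the total size of their components is at most n.
  ∑-root-size : ∀ {c} → c < r′ → ∀ h → ∑ vertices (λ u → 𝟙 (slot r′ h u ≟ c) * size c h u) ≤ n
  ∑-root-size {c} c<r′ h = begin
    ∑ vertices (λ u → 𝟙 (slot r′ h u ≟ c) * size c h u)
      ≡⟨ ∑-cong vertices (λ u → sym (∑-*ˡ vertices (𝟙 (slot r′ h u ≟ c)) _)) ⟩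
    ∑ vertices (λ u → ∑ vertices (λ x → 𝟙 (slot r′ h u ≟ c) * 𝟙 (Conn? c h u x)))
      ≡⟨ ∑-swap vertices vertices _ ⟩
    ∑ vertices (λ x → ∑ vertices (λ u → 𝟙 (slot r′ h u ≟ c) * 𝟙 (Conn? c h u x)))
      ≡⟨ ∑-cong vertices (λ x → ∑-cong vertices (λ u → sym (𝟙-× (slot r′ h u ≟ c) (Conn? c h u x)))) ⟩
    ∑ vertices (λ x → ∑ vertices (λ u → 𝟙 (slot r′ h u ≟ c ×-dec Conn? c h u x)))
      ≤⟨ ∑-mono vertices (λ x → ∑-𝟙-≤1 (λ u → slot r′ h u ≟ c ×-dec Conn? c h u x) (vertices-unique)
           (λ (k , p) (l , q) → root-unique c<r′ h (load≤ k) (load≤ l) (Conn-trans c h p (Conn-sym c h q)))) ⟩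
    ∑ vertices (λ x → 1)
      ≡⟨ ∑-vertices-1 ⟩
    n ∎
    where
    open ≤-Reasoning
    load≤ : ∀ {u} → slot r′ h u ≡ c → load h u ≤ c
    load≤ {u} k with ⊓-sel (load h u) r′
    ... | inj₁ s = ≤-reflexive (trans (sym s) k)
    ... | inj₂ s = contradiction (trans (sym k) s) (<⇒≢ c<r′)

  -- In `pairs-∷` the sizes at the target sum to `pairs c h`, while those at an owner able to use c
  -- sum to at most n. Only this asymmetry keeps the increment linear in `pairs c h`.
  pairs-step : ∀ {c} → c < r′ → ∀ h →
               ∑ allRounds (λ e → pairs c (e ∷ h)) ≤ (length allRounds + 2 * n) * pairs c h
  pairs-step {c} c<r′ h = begin
    ∑ allRounds (λ e → pairs c (e ∷ h))
      ≤⟨ ∑-mono allRounds (λ e → pairs-∷ c e h) ⟩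
    ∑ allRounds (λ e → pairs c h + 2 * (k (owner e) * size c h (owner e) * size c h (target e)))
      ≡⟨ ∑-+ allRounds _ _ ⟩
    ∑ allRounds (λ e → pairs c h) + ∑ allRounds (λ e → 2 * (k (owner e) * size c h (owner e) * size c h (target e)))
      ≡⟨ cong₂ _+_ (∑-const allRounds (pairs c h)) (∑-*ˡ allRounds 2 _) ⟩
    N * pairs c h + 2 * ∑ allRounds (λ e → k (owner e) * size c h (owner e) * size c h (target e))
      ≤⟨ +-monoʳ-≤ (N * pairs c h) (*-monoʳ-≤ 2 (∑-allRounds-≤ (λ u v → k u * size c h u * size c h v))) ⟩
    N * pairs c h + 2 * ∑ vertices (λ u → ∑ vertices (λ v → k u * size c h u * size c h v))
      ≡⟨ cong (λ s → N * pairs c h + 2 * s) (trans (∑-cong vertices (λ u → ∑-*ˡ vertices (k u * size c h u) _)) (∑-*ʳ vertices (pairs c h) _)) ⟩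
    N * pairs c h + 2 * (∑ vertices (λ u → k u * size c h u) * pairs c h)
      ≤⟨ +-monoʳ-≤ (N * pairs c h) (*-monoʳ-≤ 2 (*-monoˡ-≤ (pairs c h) (∑-root-size c<r′ h))) ⟩
    N * pairs c h + 2 * (n * pairs c h)
      ≡⟨ arith N n (pairs c h) ⟩
    (N + 2 * n) * pairs c h ∎
    where
    open ≤-Reasoning
    N = length allRounds
    k : Fin n → ℕ
    k u = 𝟙 (slot r′ h u ≟ c)
    arith : ∀ a b p → a * p + 2 * (b * p) ≡ (a + 2 * b) * p
    arith = solve-∀

  ∑-pairs-≤ : ∀ {c} → c < r′ → ∀ T →
              ∑ (outcomes T) (λ ω → pairs c (history ω)) ≤ (length allRounds + 2 * n) ^ T * n
  ∑-pairs-≤ {c} c<r′ T = ≤-trans (supermartingale (pairs c) _ (pairs-step c<r′) T [])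
    (≤-reflexive (cong ((length allRounds + 2 * n) ^ T *_) (pairs-[] c)))

-- Simple paths in the last colour

module Paths (n r′ : ℕ) where

  open Vertices n
  open Rounds n
  open Components n r′

  arc? : (a b : Fin n) (e : Round n) → Dec (a ≡ owner e × b ≡ target e)
  arc? a b e = a Fin.≟ owner e ×-dec b Fin.≟ target e

  hits : List (Round n) → Fin n → Fin n → ℕ
  hits h a b = ∑ h (λ e → 𝟙 (arc? a b e))

  -- Only final counts are kept: it is forgotten that the owner was already full when the arc
  -- arrived. The relation becomes monotone in the history and is governed by sums over rounds, to
  -- which exponential tilting applies.
  Arc : List (Round n) → Fin n → Fin n → Set
  Arc h a b = 1 ≤ hits h a b × r′ ≤ load h a

  Arc? : ∀ h a b → Dec (Arc h a b)
  Arc? h a b = 1 ≤? hits h a b ×-dec r′ ≤? load h a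

  Link : List (Round n) → Fin n → Fin n → Set
  Link h x y = Arc h x y ⊎ Arc h y x

  Link-∷ : ∀ e h {x y} → Link h x y → Link (e ∷ h) x y
  Link-∷ e h (inj₁ (p , q)) = inj₁ (≤-trans p (m≤n+m _ _) , ≤-trans q (load-≤-∷ e h _))
  Link-∷ e h (inj₂ (p , q)) = inj₂ (≤-trans p (m≤n+m _ _) , ≤-trans q (load-≤-∷ e h _))

  Conn⇒links : ∀ h {x y} → Conn r′ h x y → Star (Link h) x y
  Conn⇒links []      refl     = Star.ε
  Conn⇒links (e ∷ h) (inj₁ p) = Star.map (Link-∷ e h) (Conn⇒links h p)
  Conn⇒links (e ∷ h) (inj₂ (k , p)) = joined p
    where
    new : Arc (e ∷ h) (owner e) (target e)
    new = ≤-trans (≤-reflexive (sym (𝟙-yes (arc? _ _ e) (refl , refl)))) (m≤m+n _ _)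
        , ≤-trans (m⊓n≡n⇒n≤m k) (load-≤-∷ e h _)
    old : ∀ {x y} → Conn r′ h x y → Star (Link (e ∷ h)) x y
    old q = Star.map (Link-∷ e h) (Conn⇒links h q)
    joined : ∀ {x y} → Conn r′ h x (owner e) × Conn r′ h (target e) y ⊎ Conn r′ h x (target e) × Conn r′ h (owner e) y →
             Star (Link (e ∷ h)) x y
    joined (inj₁ (q , q′)) = old q ◅◅ (inj₁ new ◅ old q′)
    joined (inj₂ (q , q′)) = old q ◅◅ (inj₂ new ◅ old q′)

  -- The Boolean tells whether the step follows an arc in its direction.
  Steps : Set
  Steps = List (Bool × Fin n)

  trail : Fin n → Steps → List (Fin n)
  trail x p = x ∷ map proj₂ p

  end : Fin n → Steps → Fin n
  end x []            = x
  end x ((_ , y) ∷ p) = end y p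

  Step : List (Round n) → Fin n → Bool × Fin n → Set
  Step h x (true  , y) = Arc h x y
  Step h x (false , y) = Arc h y x

  Step? : ∀ h x s → Dec (Step h x s)
  Step? h x (true  , y) = Arc? h x y
  Step? h x (false , y) = Arc? h y x

  Walk : List (Round n) → Fin n → Steps → Set
  Walk h x []      = ⊤
  Walk h x (s ∷ p) = Step h x s × Walk h (proj₂ s) p

  Walk? : ∀ h x p → Dec (Walk h x p)
  Walk? h x []      = yes tt
  Walk? h x (s ∷ p) = Step? h x s ×-dec Walk? h (proj₂ s) p

  Path : List (Round n) → Fin n → Steps → Set
  Path h x p = Walk h x p × Unique (trail x p)

  Path? : ∀ h x p → Dec (Path h x p)
  Path? h x p = Walk? h x p ×-dec DecUnique.unique? Fin._≟_ (trail x p)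

  path-from : ∀ h {z} p {x} → x ∈ trail z p → Path h z p → ∃[ q ] (Path h x q × end x q ≡ end z p)
  path-from h p       (here refl) path = p , path , refl
  path-from h (s ∷ p) (there x∈) ((_ , walk) , _ ∷ p!) = path-from h p x∈ (walk , p!)

  -- Loop erasure: if x already lies on the path, the link is dropped and the part of the path from
  -- x onwards is kept.
  link-path : ∀ h {x z} → Link h x z → ∀ p → Path h z p → ∃[ q ] (Path h x q × end x q ≡ end z p)
  link-path h {x} {z} l p path with _∈?_ Fin._≟_ x (trail z p)
  ... | yes x∈ = path-from h p x∈ path
  ... | no  x∉ with l
  ...   | inj₁ a = (true  , z) ∷ p , ((a , proj₁ path) , All.¬Any⇒All¬ _ x∉ ∷ proj₂ path) , refl
  ...   | inj₂ a = (false , z) ∷ p , ((a , proj₁ path) , All.¬Any⇒All¬ _ x∉ ∷ proj₂ path) , refl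

  links⇒path : ∀ h {x y} → Star (Link h) x y → ∃[ p ] (Path h x p × end x p ≡ y)
  links⇒path h Star.ε = [] , (tt , [] ∷ []) , refl
  links⇒path h (l ◅ ls) with links⇒path h ls
  ... | p , path , eq with link-path h l p path
  ...   | q , path′ , eq′ = q , path′ , trans eq′ eq

  letters : List (Bool × Fin n)
  letters = cartesianProduct (true ∷ false ∷ []) vertices

  words : ℕ → List Steps
  words zero    = [ [] ]
  words (suc k) = cartesianProductWith _∷_ letters (words k)

  ∈-words : ∀ p → p ∈ words (length p)
  ∈-words []            = here refl
  ∈-words ((d , y) ∷ p) = Memb.∈-cartesianProductWith⁺ _∷_
    (Memb.∈-cartesianProduct⁺ (∈-bools d) (∈-vertices y)) (∈-words p)
    where
    ∈-bools : ∀ d → d ∈ true ∷ false ∷ []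
    ∈-bools true  = here refl
    ∈-bools false = there (here refl)

  length-word : ∀ k {p} → p ∈ words k → length p ≡ k
  length-word zero    (here refl) = refl
  length-word (suc k) p∈ with Memb.∈-cartesianProductWith⁻ _∷_ letters (words k) p∈
  ... | _ , q , _ , q∈ , refl = cong suc (length-word k q∈)

  ∑-words-1 : ∀ k → ∑ (words k) (λ _ → 1) ≡ (2 * n) ^ k
  ∑-words-1 zero    = refl
  ∑-words-1 (suc k) = begin
    ∑ (words (suc k)) (λ _ → 1)                ≡⟨ ∑-cartesianProductWith _∷_ letters (words k) _ ⟩
    ∑ letters (λ _ → ∑ (words k) (λ _ → 1))    ≡⟨ ∑-cong letters (λ _ → ∑-words-1 k) ⟩
    ∑ letters (λ _ → (2 * n) ^ k)              ≡⟨ ∑-cartesianProductWith _,_ (true ∷ false ∷ []) vertices _ ⟩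
    ∑ (true ∷ false ∷ []) (λ _ → ∑ vertices (λ _ → (2 * n) ^ k))
      ≡⟨ ∑-cong (true ∷ false ∷ []) (λ _ → trans (∑-const vertices _) (cong (_* (2 * n) ^ k) length-vertices)) ⟩
    n * (2 * n) ^ k + (n * (2 * n) ^ k + 0)    ≡⟨ arith n ((2 * n) ^ k) ⟩
    2 * n * (2 * n) ^ k                        ∎
    where
    open ≡-Reasoning
    arith : ∀ a b → a * b + (a * b + 0) ≡ 2 * a * b
    arith = solve-∀

  length-path : ∀ {h x} p → Path h x p → length p < n
  length-path {x = x} p (_ , p!) = begin
    suc (length p)                            ≡⟨ cong suc (sym (length-map proj₂ p)) ⟩
    length (trail x p)                        ≡⟨ sym (∑-occurrences (trail x p)) ⟩
    ∑ vertices (occurrences (trail x p))      ≤⟨ ∑-mono vertices (occurrences-≤1 p!) ⟩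
    ∑ vertices (λ _ → 1)                      ≡⟨ ∑-vertices-1 ⟩
    n                                         ∎
    where open ≤-Reasoning

  -- Union bound: a joined pair is charged to a simple path from x to y, and a word determines its
  -- end. A simple path has fewer than n steps, so finitely many lengths suffice.
  pairs≤paths : ∀ h → pairs r′ h ≤ ∑ vertices (λ x → ∑ (upTo n) (λ k → ∑ (words k) (λ p → 𝟙 (Path? h x p))))
  pairs≤paths h = ∑-mono vertices row
    where
    open ≤-Reasoning
    module _ (x : Fin n) where
      allPaths : List Steps
      allPaths = concatMap words (upTo n)
      joins : ∀ y → Conn r′ h x y → 1 ≤ ∑ allPaths (λ p → 𝟙 (end x p Fin.≟ y) * 𝟙 (Path? h x p))
      joins y c with links⇒path h (Conn⇒links h c)
      ... | p , path , eq = ≤-trans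
        (≤-reflexive (sym (cong₂ _*_ (𝟙-yes (end x p Fin.≟ y) eq) (𝟙-yes (Path? h x p) path))))
        (∈⇒≤∑ _ (Memb.∈-concatMap⁺ words (lose (Memb.∈-upTo⁺ (length-path p path)) (∈-words p))))
      row : size r′ h x ≤ ∑ (upTo n) (λ k → ∑ (words k) (λ p → 𝟙 (Path? h x p)))
      row = begin
        ∑ vertices (λ y → 𝟙 (Conn? r′ h x y))
          ≤⟨ ∑-mono vertices (λ y → 𝟙-≤ (Conn? r′ h x y) (joins y)) ⟩
        ∑ vertices (λ y → ∑ allPaths (λ p → 𝟙 (end x p Fin.≟ y) * 𝟙 (Path? h x p)))
          ≡⟨ ∑-swap vertices allPaths _ ⟩
        ∑ allPaths (λ p → ∑ vertices (λ y → 𝟙 (end x p Fin.≟ y) * 𝟙 (Path? h x p)))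
          ≡⟨ ∑-cong allPaths (λ p → trans (∑-*ʳ vertices (𝟙 (Path? h x p)) _)
               (trans (cong (_* 𝟙 (Path? h x p)) (∑-≟ (end x p))) (*-identityˡ _))) ⟩
        ∑ allPaths (λ p → 𝟙 (Path? h x p))
          ≡⟨ ∑-concatMap words (upTo n) _ ⟩
        ∑ (upTo n) (λ k → ∑ (words k) (λ p → 𝟙 (Path? h x p))) ∎

  -- An inner vertex may own both of its path arcs, so a joint list of owners could repeat. Split by
  -- direction, both lists are free of repetitions on a simple path, and such a vertex is tilted
  -- twice.
  forwardOwners backwardOwners : Fin n → Steps → List (Fin n)
  forwardOwners x []                 = []
  forwardOwners x ((true  , y) ∷ p)  = x ∷ forwardOwners y p
  forwardOwners x ((false , y) ∷ p)  = forwardOwners y p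
  backwardOwners x []                = []
  backwardOwners x ((true  , y) ∷ p) = backwardOwners y p
  backwardOwners x ((false , y) ∷ p) = y ∷ backwardOwners y p

  arcList : Fin n → Steps → List (Fin n × Fin n)
  arcList x []                = []
  arcList x ((true  , y) ∷ p) = (x , y) ∷ arcList y p
  arcList x ((false , y) ∷ p) = (y , x) ∷ arcList y p

  length-owners : ∀ x p → length (forwardOwners x p) + length (backwardOwners x p) ≡ length p
  length-owners x []                = refl
  length-owners x ((true  , y) ∷ p) = cong suc (length-owners y p)
  length-owners x ((false , y) ∷ p) = trans (+-suc (length (forwardOwners y p)) _) (cong suc (length-owners y p))

  length-arcList : ∀ x p → length (arcList x p) ≡ length p
  length-arcList x []                = refl
  length-arcList x ((true  , y) ∷ p) = cong suc (length-arcList y p)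
  length-arcList x ((false , y) ∷ p) = cong suc (length-arcList y p)

  forwardOwners-occ : ∀ x p u → occurrences (forwardOwners x p) u ≤ occurrences (trail x p) u
  forwardOwners-occ x []                u = z≤n
  forwardOwners-occ x ((true  , y) ∷ p) u = +-monoʳ-≤ (𝟙 (x Fin.≟ u)) (forwardOwners-occ y p u)
  forwardOwners-occ x ((false , y) ∷ p) u = ≤-trans (forwardOwners-occ y p u) (m≤n+m _ (𝟙 (x Fin.≟ u)))

  backwardOwners-occ : ∀ x p u → occurrences (backwardOwners x p) u ≤ occurrences (map proj₂ p) u
  backwardOwners-occ x []                u = z≤n
  backwardOwners-occ x ((true  , y) ∷ p) u = ≤-trans (backwardOwners-occ y p u) (m≤n+m _ (𝟙 (y Fin.≟ u)))
  backwardOwners-occ x ((false , y) ∷ p) u = +-monoʳ-≤ (𝟙 (y Fin.≟ u)) (backwardOwners-occ y p u)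

  arcList-avoids : ∀ {z} x p → All (z ≢_) (trail x p) → All (λ (a , b) → z ≢ a × z ≢ b) (arcList x p)
  arcList-avoids x []                _                = []
  arcList-avoids x ((true  , y) ∷ p) (z≢x ∷ z≢y ∷ zs) = (z≢x , z≢y) ∷ arcList-avoids y p (z≢y ∷ zs)
  arcList-avoids x ((false , y) ∷ p) (z≢x ∷ z≢y ∷ zs) = (z≢y , z≢x) ∷ arcList-avoids y p (z≢y ∷ zs)

  arcList-unique : ∀ x p → Unique (trail x p) → Unique (arcList x p)
  arcList-unique x []                _           = []
  arcList-unique x ((true  , y) ∷ p) (x∉ ∷ p!) =
    All.map (λ (x≢a , _) eq → x≢a (cong proj₁ eq)) (arcList-avoids y p x∉) ∷ arcList-unique y p p!
  arcList-unique x ((false , y) ∷ p) (x∉ ∷ p!) =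
    All.map (λ (_ , x≢b) eq → x≢b (cong proj₂ eq)) (arcList-avoids y p x∉) ∷ arcList-unique y p p!

  forwardOwners-loaded : ∀ h x p → Walk h x p → All (λ a → r′ ≤ load h a) (forwardOwners x p)
  forwardOwners-loaded h x []                _             = []
  forwardOwners-loaded h x ((true  , y) ∷ p) (arc , walk) = proj₂ arc ∷ forwardOwners-loaded h y p walk
  forwardOwners-loaded h x ((false , y) ∷ p) (_   , walk) = forwardOwners-loaded h y p walk

  backwardOwners-loaded : ∀ h x p → Walk h x p → All (λ a → r′ ≤ load h a) (backwardOwners x p)
  backwardOwners-loaded h x []                _             = []
  backwardOwners-loaded h x ((true  , y) ∷ p) (_   , walk) = backwardOwners-loaded h y p walk
  backwardOwners-loaded h x ((false , y) ∷ p) (arc , walk) = proj₂ arc ∷ backwardOwners-loaded h y p walk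

  arcList-hit : ∀ h x p → Walk h x p → All (λ (a , b) → 1 ≤ hits h a b) (arcList x p)
  arcList-hit h x []                _             = []
  arcList-hit h x ((true  , y) ∷ p) (arc , walk) = proj₁ arc ∷ arcList-hit h y p walk
  arcList-hit h x ((false , y) ∷ p) (arc , walk) = proj₁ arc ∷ arcList-hit h y p walk

  arcCount : List (Fin n × Fin n) → Round n → ℕ
  arcCount as e = ∑ as (λ (a , b) → 𝟙 (arc? a b e))

  arcCount-≤1 : ∀ {as} → Unique as → ∀ e → arcCount as e ≤ 1
  arcCount-≤1 as! e = ∑-𝟙-≤1 (λ (a , b) → arc? a b e) as!
    (λ (p , q) (p′ , q′) → cong₂ _,_ (trans p (sym p′)) (trans q (sym q′)))

  ∑-arcCount : ∀ as → ∑ allRounds (arcCount as) ≤ length as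
  ∑-arcCount as = begin
    ∑ allRounds (arcCount as)                                         ≡⟨ ∑-swap allRounds as _ ⟩
    ∑ as (λ (a , b) → ∑ allRounds (λ e → 𝟙 (arc? a b e)))             ≤⟨ ∑-bound as 1 (λ (a , b) → single a b) ⟩
    length as * 1                                                     ≡⟨ *-identityʳ _ ⟩
    length as                                                         ∎
    where
    open ≤-Reasoning
    single : ∀ a b → ∑ allRounds (λ e → 𝟙 (arc? a b e)) ≤ 1
    single a b = begin
      ∑ allRounds (λ e → 𝟙 (arc? a b e))
        ≤⟨ ∑-allRounds-≤ (λ u v → 𝟙 (a Fin.≟ u ×-dec b Fin.≟ v)) ⟩
      ∑ vertices (λ u → ∑ vertices (λ v → 𝟙 (a Fin.≟ u ×-dec b Fin.≟ v)))
        ≡⟨ ∑-cong vertices (λ u → trans (∑-cong vertices (λ v → 𝟙-× (a Fin.≟ u) (b Fin.≟ v)))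
             (trans (∑-*ˡ vertices (𝟙 (a Fin.≟ u)) _) (cong (𝟙 (a Fin.≟ u) *_) (∑-≟ b)))) ⟩
      ∑ vertices (λ u → 𝟙 (a Fin.≟ u) * 1)
        ≡⟨ trans (∑-*ʳ vertices 1 _) (trans (*-identityʳ _) (∑-≟ a)) ⟩
      1 ∎

  length*≤∑ : ∀ {X : Set} (xs : List X) (f : X → ℕ) {c} → All (λ x → c ≤ f x) xs → length xs * c ≤ ∑ xs f
  length*≤∑ []       f []       = z≤n
  length*≤∑ (x ∷ xs) f (p ∷ ps) = +-mono-≤ p (length*≤∑ xs f ps)

  owners-weight : ∀ h as → All (λ a → r′ ≤ load h a) as → length as * r′ ≤ ∑ h (occurrences as ∘ owner)
  owners-weight h as loaded = ≤-trans (length*≤∑ as (load h) loaded) (≤-reflexive (∑-swap as h _))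

  arcs-weight : ∀ h as → All (λ (a , b) → 1 ≤ hits h a b) as → length as ≤ ∑ h (arcCount as)
  arcs-weight h as hit = begin
    length as                     ≡⟨ sym (*-identityʳ _) ⟩
    length as * 1                 ≤⟨ length*≤∑ as (uncurry (hits h)) hit ⟩
    ∑ as (uncurry (hits h))       ≡⟨ ∑-swap as h _ ⟩
    ∑ h (arcCount as)             ∎
    where open ≤-Reasoning

-- Exponential moments for one path: a round is tilted by (b + 1)/b when it is
-- owned by an owner of a path arc, and by 1 + M when it realises a path arc.
module PathWeight (m r′ b M : ℕ) where

  n = suc m

  open Vertices n
  open Rounds n
  open PositiveRounds m
  open Components n r′
  open Paths n r′

  weight : Fin n → Steps → Round n → ℕ
  weight x p e = (b + 1 * occurrences (forwardOwners x p) (owner e))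
               * (b + 1 * occurrences (backwardOwners x p) (owner e))
               * (1 + M * arcCount (arcList x p) e)

  -- `∏-lower` is applied to each factor of `weight`: every listed owner accounts for r′ rounds and
  -- every arc for one. A vertex in both owner lists counts in both factors, so the total exponent
  -- is k * r′ for any mixture of directions.
  weight-lower : ∀ h x p → Path h x p → let k = length p in
    (b + 1) ^ (k * r′) * (b * b) ^ length h * (1 + M) ^ k ≤ b ^ (k * r′) * ∏ h (weight x p)
  weight-lower h x p (walk , p!) = begin
    (b + 1) ^ (k * r′) * (b * b) ^ t * (1 + M) ^ k
      ≡⟨ cong₂ (λ s s′ → s * s′ * (1 + M) ^ k) (split (b + 1)) (^-distribʳ-* t b b) ⟩
    (b + 1) ^ (f * r′) * (b + 1) ^ (g * r′) * (b ^ t * b ^ t) * (1 + M) ^ k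
      ≡⟨ arith₁ ((b + 1) ^ (f * r′)) ((b + 1) ^ (g * r′)) (b ^ t) ((1 + M) ^ k) ⟩
    ((b + 1) ^ (f * r′) * b ^ t) * ((b + 1) ^ (g * r′) * b ^ t) * ((1 + M) ^ k * 1)
      ≤⟨ *-mono-≤ (*-mono-≤ forward backward) arcs′ ⟩
    (b ^ (f * r′) * ∏ h wF) * (b ^ (g * r′) * ∏ h wB) * (1 * ∏ h wA)
      ≡⟨ arith₂ (b ^ (f * r′)) (b ^ (g * r′)) (∏ h wF) (∏ h wB) (∏ h wA) ⟩
    b ^ (f * r′) * b ^ (g * r′) * (∏ h wF * ∏ h wB * ∏ h wA)
      ≡⟨ cong₂ _*_ (sym (split b)) (sym (trans (∏-* h _ wA) (cong (_* ∏ h wA) (∏-* h wF wB)))) ⟩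
    b ^ (k * r′) * ∏ h (weight x p) ∎
    where
    open ≤-Reasoning
    k = length p
    t = length h
    f = length (forwardOwners x p)
    g = length (backwardOwners x p)
    wF wB wA : Round n → ℕ
    wF e = b + 1 * occurrences (forwardOwners x p) (owner e)
    wB e = b + 1 * occurrences (backwardOwners x p) (owner e)
    wA e = 1 + M * arcCount (arcList x p) e
    split : ∀ c → c ^ (k * r′) ≡ c ^ (f * r′) * c ^ (g * r′)
    split c = trans (cong (λ k → c ^ (k * r′)) (sym (length-owners x p)))
      (trans (cong (c ^_) (*-distribʳ-+ r′ f g)) (^-distribˡ-+-* c (f * r′) (g * r′)))
    forward : (b + 1) ^ (f * r′) * b ^ t ≤ b ^ (f * r′) * ∏ h wF
    forward = ∏-lower h (occurrences (forwardOwners x p) ∘ owner) b 1 (f * r′)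
      (λ e → ≤-trans (forwardOwners-occ x p (owner e)) (occurrences-≤1 p! (owner e)))
      (owners-weight h _ (forwardOwners-loaded h x p walk))
    backward : (b + 1) ^ (g * r′) * b ^ t ≤ b ^ (g * r′) * ∏ h wB
    backward = ∏-lower h (occurrences (backwardOwners x p) ∘ owner) b 1 (g * r′)
      (λ e → ≤-trans (backwardOwners-occ x p (owner e)) (occurrences-≤1 (AllPairs.tail p!) (owner e)))
      (owners-weight h _ (backwardOwners-loaded h x p walk))
    arcs′ : (1 + M) ^ k * 1 ≤ 1 * ∏ h wA
    arcs′ = begin
      (1 + M) ^ k * 1              ≡⟨ cong ((1 + M) ^ k *_) (sym (^-zeroˡ t)) ⟩
      (1 + M) ^ k * 1 ^ t          ≤⟨ ∏-lower h (arcCount (arcList x p)) 1 M k (arcCount-≤1 (arcList-unique x p p!))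
                                        (≤-trans (≤-reflexive (sym (length-arcList x p))) (arcs-weight h _ (arcList-hit h x p walk))) ⟩
      1 ^ k * ∏ h wA               ≡⟨ cong (_* ∏ h wA) (^-zeroˡ k) ⟩
      1 * ∏ h wA                   ∎
    arith₁ : ∀ a a′ c d → a * a′ * (c * c) * d ≡ (a * c) * (a′ * c) * (d * 1)
    arith₁ = solve-∀
    arith₂ : ∀ a a′ c d e → (a * c) * (a′ * d) * (1 * e) ≡ a * a′ * (c * d * e)
    arith₂ = solve-∀

  module _ (M-small : M * ((b + 1) * (b + 1)) ≤ m) where

    -- Above the base weight b * b, each arc adds b through its owner. A vertex in both lists adds 1
    -- more, bounded by the number of forward owners. By `M-small` an arc tilt adds at most m in
    -- total, again one unit. Hence b + 2 per step of the path.
    ∑-weight : ∀ x p → Unique (trail x p) → ∑ allRounds (weight x p) ≤ m * (n * (b * b) + length p * (b + 2))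
    ∑-weight x p p! = begin
      ∑ allRounds (weight x p)
        ≤⟨ ∑-mono allRounds pointwise ⟩
      ∑ allRounds (λ e → g (owner e) + M * ((b + 1) * (b + 1)) * arcCount (arcList x p) e)
        ≡⟨ trans (∑-+ allRounds _ _) (cong₂ _+_ (∑-owner g) (∑-*ˡ allRounds (M * ((b + 1) * (b + 1))) _)) ⟩
      m * ∑ vertices g + M * ((b + 1) * (b + 1)) * ∑ allRounds (arcCount (arcList x p))
        ≤⟨ +-mono-≤ (*-monoʳ-≤ m ∑-g) (*-mono-≤ M-small (≤-trans (∑-arcCount (arcList x p)) (≤-reflexive (length-arcList x p)))) ⟩
      m * (n * (b * b) + (length p * b + length p)) + m * length p
        ≡⟨ arith m (n * (b * b)) (length p) b ⟩
      m * (n * (b * b) + length p * (b + 2)) ∎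
      where
      open ≤-Reasoning
      F B : Fin n → ℕ
      F = occurrences (forwardOwners x p)
      B = occurrences (backwardOwners x p)
      g : Fin n → ℕ
      g u = b * b + (b * (F u + B u) + F u)
      F≤1 : ∀ u → F u ≤ 1
      F≤1 u = ≤-trans (forwardOwners-occ x p u) (occurrences-≤1 p! u)
      B≤1 : ∀ u → B u ≤ 1
      B≤1 u = ≤-trans (backwardOwners-occ x p u) (occurrences-≤1 (AllPairs.tail p!) u)
      pointwise : ∀ e → weight x p e ≤ g (owner e) + M * ((b + 1) * (b + 1)) * arcCount (arcList x p) e
      pointwise e = begin
        (b + 1 * F u) * (b + 1 * B u) * (1 + M * c)
          ≡⟨ expand b (F u) (B u) M c ⟩
        (b * b + (b * (F u + B u) + F u * B u)) + M * ((b + F u) * (b + B u)) * c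
          ≤⟨ +-mono-≤ (+-monoʳ-≤ (b * b) (+-monoʳ-≤ (b * (F u + B u)) (≤-trans (*-monoʳ-≤ (F u) (B≤1 u)) (≤-reflexive (*-identityʳ _)))))
                      (*-monoˡ-≤ c (*-monoʳ-≤ M (*-mono-≤ (+-monoʳ-≤ b (F≤1 u)) (+-monoʳ-≤ b (B≤1 u))))) ⟩
        g u + M * ((b + 1) * (b + 1)) * c ∎
        where
        u = owner e
        c = arcCount (arcList x p) e
        expand : ∀ b f g M c → (b + 1 * f) * (b + 1 * g) * (1 + M * c) ≡ (b * b + (b * (f + g) + f * g)) + M * ((b + f) * (b + g)) * c
        expand = solve-∀
      ∑-g : ∑ vertices g ≤ n * (b * b) + (length p * b + length p)
      ∑-g = begin
        ∑ vertices g
          ≡⟨ trans (∑-+ vertices _ _) (cong₂ _+_ (trans (∑-const vertices (b * b)) (cong (_* (b * b)) length-vertices))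
               (trans (∑-+ vertices _ _) (cong₂ _+_ (trans (∑-*ˡ vertices b _) (cong (b *_) (∑-+ vertices F B))) (∑-occurrences (forwardOwners x p))))) ⟩
        n * (b * b) + (b * (∑ vertices F + ∑ vertices B) + length (forwardOwners x p))
          ≡⟨ cong (λ s → n * (b * b) + (s + length (forwardOwners x p)))
               (trans (cong (b *_) (trans (cong₂ _+_ (∑-occurrences (forwardOwners x p)) (∑-occurrences (backwardOwners x p))) (length-owners x p)))
                      (*-comm b (length p))) ⟩
        n * (b * b) + (length p * b + length (forwardOwners x p))
          ≤⟨ +-monoʳ-≤ (n * (b * b)) (+-monoʳ-≤ (length p * b)
               (≤-trans (m≤m+n _ (length (backwardOwners x p))) (≤-reflexive (length-owners x p)))) ⟩
        n * (b * b) + (length p * b + length p) ∎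
      arith : ∀ m d k b → m * (d + (k * b + k)) + m * k ≡ m * (d + k * (b + 2))
      arith = solve-∀

    -- Markov's inequality for the product of the weights, whose mean is controlled by
    -- `supermartingale`. A word that repeats a vertex contributes nothing.
    path-probability : ∀ T x p → let k = length p in
      ∑ (outcomes T) (λ ω → 𝟙 (Path? (history ω) x p)) * ((b + 1) ^ (k * r′) * (b * b) ^ T * (1 + M) ^ k)
        ≤ b ^ (k * r′) * (m * (n * (b * b) + k * (b + 2))) ^ T
    path-probability T x p with DecUnique.unique? Fin._≟_ (trail x p)
    ... | no ¬p! = ≤-trans (≤-reflexive (cong (_* ((b + 1) ^ (length p * r′) * (b * b) ^ T * (1 + M) ^ length p))
        (∑-zero (outcomes T) (λ ω → 𝟙-no (Walk? (history ω) x p ×-dec no ¬p!) (λ (_ , p!) → ¬p! p!))))) z≤n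
    ... | yes p! = begin
      ∑ (outcomes T) (λ ω → 𝟙 (path? ω)) * L
        ≡⟨ sym (∑-*ʳ (outcomes T) L _) ⟩
      ∑ (outcomes T) (λ ω → 𝟙 (path? ω) * L)
        ≤⟨ ∑-mono (outcomes T) (λ ω → pointwise ω (path? ω)) ⟩
      ∑ (outcomes T) (λ ω → b ^ (k * r′) * ∏ (history ω) (weight x p))
        ≡⟨ ∑-*ˡ (outcomes T) (b ^ (k * r′)) _ ⟩
      b ^ (k * r′) * ∑ (outcomes T) (λ ω → ∏ (history ω) (weight x p))
        ≤⟨ *-monoʳ-≤ (b ^ (k * r′)) (supermartingale (λ h → ∏ h (weight x p)) A step T []) ⟩
      b ^ (k * r′) * (A ^ T * 1)
        ≡⟨ cong (b ^ (k * r′) *_) (*-identityʳ _) ⟩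
      b ^ (k * r′) * A ^ T ∎
      where
      open ≤-Reasoning
      k = length p
      A = m * (n * (b * b) + k * (b + 2))
      L = (b + 1) ^ (k * r′) * (b * b) ^ T * (1 + M) ^ k
      path? : (ω : Vec (Round n) T) → Dec (Path (history ω) x p)
      path? ω = Walk? (history ω) x p ×-dec yes p!
      pointwise : ∀ ω (path? : Dec (Path (history ω) x p)) → 𝟙 path? * L ≤ b ^ (k * r′) * ∏ (history ω) (weight x p)
      pointwise ω (no _)     = z≤n
      pointwise ω (yes path) = begin
        1 * L        ≡⟨ *-identityˡ L ⟩
        L            ≡⟨ cong (λ t → (b + 1) ^ (k * r′) * (b * b) ^ t * (1 + M) ^ k)
                          (sym (trans (length-history ω []) (+-identityʳ T))) ⟩
        (b + 1) ^ (k * r′) * (b * b) ^ length (history ω) * (1 + M) ^ k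
                     ≤⟨ weight-lower (history ω) x p path ⟩
        b ^ (k * r′) * ∏ (history ω) (weight x p) ∎
      step : ∀ h → ∑ allRounds (λ e → ∏ (e ∷ h) (weight x p)) ≤ A * ∏ h (weight x p)
      step h = ≤-trans (≤-reflexive (∑-*ʳ allRounds (∏ h (weight x p)) (weight x p)))
                       (*-monoˡ-≤ (∏ h (weight x p)) (∑-weight x p p!))

-- Exponential inequalities

bernoulli : ∀ D c k → (D + k * c) * D ^ k ≤ D * (D + c) ^ k
bernoulli D c zero    = ≤-reflexive (cong (_* 1) (+-identityʳ D))
bernoulli D c (suc k) = begin
  (D + (c + k * c)) * (D * D ^ k)             ≤⟨ m≤m+n _ (k * c * c * D ^ k) ⟩
  (D + (c + k * c)) * (D * D ^ k) + k * c * c * D ^ k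
                                              ≡⟨ arith D c (k * c) (D ^ k) ⟩
  (D + c) * ((D + k * c) * D ^ k)             ≤⟨ *-monoʳ-≤ (D + c) (bernoulli D c k) ⟩
  (D + c) * (D * (D + c) ^ k)                 ≡⟨ arith′ (D + c) D ((D + c) ^ k) ⟩
  D * ((D + c) * (D + c) ^ k)                 ∎
  where
  open ≤-Reasoning
  arith : ∀ D c e p → (D + (c + e)) * (D * p) + e * c * p ≡ (D + c) * ((D + e) * p)
  arith = solve-∀
  arith′ : ∀ a b p → a * (b * p) ≡ b * (a * p)
  arith′ = solve-∀

-- The form (1 + c/D)^k (1 - kc/D) ≤ 1 of Bernoulli's inequality. One step is (D + c)(z ∸ c) ≤ D z
-- for z ≤ D; once k * c reaches D the left side is zero.
bernoulli-∸ : ∀ D c k → (D + c) ^ k * (D ∸ k * c) ≤ D ^ suc k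
bernoulli-∸ D c zero    = ≤-reflexive (*-comm 1 D)
bernoulli-∸ D c (suc k) = begin
  (D + c) * (D + c) ^ k * (D ∸ (c + k * c))     ≡⟨ cong (λ z → (D + c) * (D + c) ^ k * z) (trans (cong (D ∸_) (+-comm c (k * c))) (sym (∸-+-assoc D (k * c) c))) ⟩
  (D + c) * (D + c) ^ k * (D ∸ k * c ∸ c)       ≡⟨ arith (D + c) ((D + c) ^ k) (D ∸ k * c ∸ c) ⟩
  (D + c) ^ k * ((D + c) * (D ∸ k * c ∸ c))     ≤⟨ *-monoʳ-≤ ((D + c) ^ k) (shrink (D ∸ k * c) (m∸n≤m D (k * c))) ⟩
  (D + c) ^ k * (D * (D ∸ k * c))               ≡⟨ arith′ ((D + c) ^ k) D (D ∸ k * c) ⟩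
  D * ((D + c) ^ k * (D ∸ k * c))               ≤⟨ *-monoʳ-≤ D (bernoulli-∸ D c k) ⟩
  D * D ^ suc k                                 ∎
  where
  open ≤-Reasoning
  arith : ∀ a p z → a * p * z ≡ p * (a * z)
  arith = solve-∀
  arith′ : ∀ p a z → p * (a * z) ≡ a * (p * z)
  arith′ = solve-∀
  shrink : ∀ z → z ≤ D → (D + c) * (z ∸ c) ≤ D * z
  shrink z z≤D with ≤-total z c
  ... | inj₁ z≤c = ≤-trans (≤-reflexive (trans (cong ((D + c) *_) (m≤n⇒m∸n≡0 z≤c)) (*-zeroʳ (D + c)))) z≤n
  ... | inj₂ c≤z = begin
    (D + c) * (z ∸ c)                ≡⟨ *-distribʳ-+ (z ∸ c) D c ⟩
    D * (z ∸ c) + c * (z ∸ c)        ≤⟨ +-monoʳ-≤ (D * (z ∸ c)) (*-monoʳ-≤ c (≤-trans (m∸n≤m z c) z≤D)) ⟩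
    D * (z ∸ c) + c * D              ≡⟨ cong (D * (z ∸ c) +_) (*-comm c D) ⟩
    D * (z ∸ c) + D * c              ≡⟨ sym (*-distribˡ-+ D (z ∸ c) c) ⟩
    D * (z ∸ c + c)                  ≡⟨ cong (D *_) (m∸n+n≡m c≤z) ⟩
    D * z                            ∎

-- Multiplying the left side by y ^ (E ∸ T) and then raising that factor to x ^ (E ∸ T) reduces it
-- to the hypothesis. This lets a multiple of a block length replace the actual number of rounds.
^-shrink : ∀ {x y T E} X Y .{{_ : NonZero y}} → y ≤ x → T ≤ E → x ^ E * X ≤ y ^ E * Y → x ^ T * X ≤ y ^ T * Y
^-shrink {x} {y} {T} {E} X Y y≤x T≤E h = *-cancelˡ-≤ (y ^ (E ∸ T)) {{m^n≢0 y (E ∸ T)}} (begin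
  y ^ (E ∸ T) * (x ^ T * X)     ≤⟨ *-monoˡ-≤ (x ^ T * X) (^-monoˡ-≤ (E ∸ T) y≤x) ⟩
  x ^ (E ∸ T) * (x ^ T * X)     ≡⟨ join x X ⟩
  x ^ E * X                     ≤⟨ h ⟩
  y ^ E * Y                     ≡⟨ sym (join y Y) ⟩
  y ^ (E ∸ T) * (y ^ T * Y)     ∎)
  where
  open ≤-Reasoning
  join : ∀ z Z → z ^ (E ∸ T) * (z ^ T * Z) ≡ z ^ E * Z
  join z Z = trans (sym (*-assoc (z ^ (E ∸ T)) (z ^ T) Z))
    (cong (_* Z) (trans (sym (^-distribˡ-+-* z (E ∸ T) T)) (cong (z ^_) (m∸n+n≡m T≤E))))

geometric-sum : ∀ (Z : ℕ → ℕ) X n → (∀ k → Z k * 2 ^ k ≤ X) → ∑ (upTo n) Z ≤ 2 * X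
geometric-sum Z X n bound = ≤-trans (≤-reflexive (sym (*-identityʳ _)))
  (scaled n (λ k → k) 1 (λ k → ≤-trans (≤-reflexive (cong (Z k *_) (*-identityˡ (2 ^ k)))) (bound k)))
  where
  open ≤-Reasoning
  -- `f` records the shift of the index and `c` the power of two gathered so far, so the induction
  -- avoids division.
  scaled : ∀ n (f : ℕ → ℕ) c → (∀ k → Z (f k) * (c * 2 ^ k) ≤ X) → ∑ (applyUpTo f n) Z * c ≤ 2 * X
  scaled zero    f c bound = z≤n
  scaled (suc n) f c bound = begin
    (Z (f 0) + tail) * c      ≡⟨ *-distribʳ-+ c (Z (f 0)) tail ⟩
    Z (f 0) * c + tail * c    ≤⟨ +-mono-≤ (≤-trans (≤-reflexive (cong (Z (f 0) *_) (sym (*-identityʳ c)))) (bound 0)) tail-≤ ⟩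
    X + X                     ≡⟨ cong (X +_) (sym (+-identityʳ X)) ⟩
    2 * X                     ∎
    where
    tail = ∑ (applyUpTo (λ k → f (suc k)) n) Z
    double : ∀ a c p → a * (2 * c * p) ≡ a * (c * (2 * p))
    double = solve-∀
    double′ : ∀ a c → 2 * (a * c) ≡ a * (2 * c)
    double′ = solve-∀
    tail-≤ : tail * c ≤ X
    tail-≤ = *-cancelˡ-≤ 2 (≤-trans (≤-reflexive (double′ tail c))
      (scaled n (λ k → f (suc k)) (2 * c) (λ k → ≤-trans (≤-reflexive (double (Z (f (suc k))) c (2 ^ k))) (bound (suc k)))))

-- For n = suc m, the ratio of the two bases is 1 + 2/(n − 1).
growth-bound : ∀ m r T → 20 ≤ suc m → T ≤ r * suc m →
  (suc m * m + 2 * suc m) ^ T ≤ 2 ^ (6 * r) * (suc m * m) ^ T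
growth-bound zero      r T (s≤s ()) _
growth-bound m@(suc _) r T 20≤n T≤rn = begin
  (N + 2 * n) ^ T                     ≡⟨ sym (*-identityʳ _) ⟩
  (N + 2 * n) ^ T * 1                 ≤⟨ ^-shrink 1 (2 ^ (6 * r)) (m≤m+n N (2 * n)) T≤E long ⟩
  N ^ T * 2 ^ (6 * r)                 ≡⟨ *-comm (N ^ T) _ ⟩
  2 ^ (6 * r) * N ^ T                 ∎
  where
  open ≤-Reasoning
  n = suc m
  N = n * m
  -- A block of n / 5 rounds at most doubles the count, because 4k ≤ m. From n ≥ 20 on, six blocks
  -- cover n rounds, whence the exponent 6 * r.
  k = n / 5
  4≤k : 4 ≤ k
  4≤k = /-monoˡ-≤ 5 20≤n
  5k≤n : k * 5 ≤ n
  5k≤n = m/n*n≤m n 5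
  n≤6k : n ≤ 6 * k
  n≤6k = begin
    n                 ≡⟨ m≡m%n+[m/n]*n n 5 ⟩
    n % 5 + k * 5     ≤⟨ +-monoˡ-≤ (k * 5) (≤-trans (≤-pred (m%n<n n 5)) 4≤k) ⟩
    k + k * 5         ≡⟨ arith k ⟩
    6 * k             ∎
    where
    arith : ∀ k → k + k * 5 ≡ 6 * k
    arith = solve-∀
  4k≤m : k * 4 ≤ m
  4k≤m = ≤-pred (begin
    1 + k * 4         ≤⟨ +-monoˡ-≤ (k * 4) (≤-trans (s≤s z≤n) 4≤k) ⟩
    k + k * 4         ≡⟨ sym (*-suc k 4) ⟩
    k * 5             ≤⟨ 5k≤n ⟩
    n                 ∎)
  T≤E : T ≤ k * (6 * r)
  T≤E = ≤-trans T≤rn (≤-trans (*-monoʳ-≤ r n≤6k) (≤-reflexive (arith r k)))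
    where
    arith : ∀ r k → r * (6 * k) ≡ k * (6 * r)
    arith = solve-∀
  half : N ≤ 2 * (N ∸ k * (2 * n))
  half = begin
    N                              ≡⟨ sym (m+n∸n≡m N N) ⟩
    N + N ∸ N                      ≤⟨ ∸-monoʳ-≤ (N + N) (≤-trans (≤-reflexive (arith k n)) (*-monoʳ-≤ n 4k≤m)) ⟩
    N + N ∸ 2 * (k * (2 * n))      ≡⟨ cong (λ s → N + s ∸ 2 * (k * (2 * n))) (sym (+-identityʳ N)) ⟩
    2 * N ∸ 2 * (k * (2 * n))      ≡⟨ sym (*-distribˡ-∸ 2 N (k * (2 * n))) ⟩
    2 * (N ∸ k * (2 * n))          ∎
    where
    arith : ∀ k n → 2 * (k * (2 * n)) ≡ n * (k * 4)
    arith = solve-∀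
  block : (N + 2 * n) ^ k ≤ 2 * N ^ k
  block = *-cancelˡ-≤ N (begin
    N * (N + 2 * n) ^ k                             ≤⟨ *-monoˡ-≤ _ half ⟩
    2 * (N ∸ k * (2 * n)) * (N + 2 * n) ^ k         ≡⟨ arith (N ∸ k * (2 * n)) ((N + 2 * n) ^ k) ⟩
    2 * ((N + 2 * n) ^ k * (N ∸ k * (2 * n)))       ≤⟨ *-monoʳ-≤ 2 (bernoulli-∸ N (2 * n) k) ⟩
    2 * (N * N ^ k)                                 ≡⟨ arith′ N (N ^ k) ⟩
    N * (2 * N ^ k)                                 ∎)
    where
    arith : ∀ a b → 2 * a * b ≡ 2 * (b * a)
    arith = solve-∀
    arith′ : ∀ a b → 2 * (a * b) ≡ a * (2 * b)
    arith′ = solve-∀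
  long : (N + 2 * n) ^ (k * (6 * r)) * 1 ≤ N ^ (k * (6 * r)) * 2 ^ (6 * r)
  long = begin
    (N + 2 * n) ^ (k * (6 * r)) * 1        ≡⟨ trans (*-identityʳ _) (sym (^-*-assoc (N + 2 * n) k (6 * r))) ⟩
    ((N + 2 * n) ^ k) ^ (6 * r)            ≤⟨ ^-monoˡ-≤ (6 * r) block ⟩
    (2 * N ^ k) ^ (6 * r)                  ≡⟨ ^-distribʳ-* (6 * r) 2 (N ^ k) ⟩
    2 ^ (6 * r) * (N ^ k) ^ (6 * r)        ≡⟨ cong (2 ^ (6 * r) *_) (^-*-assoc N k (6 * r)) ⟩
    2 ^ (6 * r) * N ^ (k * (6 * r))        ≡⟨ *-comm (2 ^ (6 * r)) _ ⟩
    N ^ (k * (6 * r)) * 2 ^ (6 * r)        ∎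

-- Chernoff bound at slack ε ≥ 1/μ₀: the tilt is 1/b with b = 8 μ₀, and each of
-- the r colours gains a factor 1 + 1/q.
module Chernoff (μ₀ : ℕ) .{{_ : NonZero μ₀}} where

  μ b q H : ℕ
  -- A block of at most (1 - 1/μ)n rounds costs about (1 - 1/μ)(1/b + 2/b²) in the exponent, against
  -- log(1 + 1/b) ≈ 1/b - 1/(2b²). With b = 4μ the slack 1/(μb) = 4/b² exceeds the second-order
  -- losses 5/(2b²), leaving room for 1/q = 1/b². In `H` the 4 stands for two directions times a
  -- ratio 1/2 of the series over path lengths.
  μ  = 2 * μ₀
  b  = 4 * μ
  q  = 16 * (μ * μ)
  H  = 4 * ((b + 1) * (b + 1))

  private
    instance
      μ-nonZero : NonZero μ
      μ-nonZero = m*n≢0 2 μ₀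
      b-nonZero : NonZero b
      b-nonZero = m*n≢0 4 μ
      q-nonZero : NonZero q
      q-nonZero = m*n≢0 16 (μ * μ) {{_}} {{m*n≢0 μ μ}}

  abstract
    r₀ : ℕ
    r₀ = 2 * H * q

    -- Bernoulli's inequality gives (1 + 1/q)^r ≥ r/q, which explains `r₀`. The 2 beside `H` will
    -- pay for the difference between r and r′.
    gain : ∀ r → r₀ ≤ r → 2 * H * q ^ r ≤ (q + 1) ^ r
    gain r r₀≤r = *-cancelˡ-≤ q (begin
      q * (2 * H * q ^ r)         ≡⟨ arith q (2 * H) (q ^ r) ⟩
      2 * H * q * q ^ r           ≤⟨ *-monoˡ-≤ (q ^ r) (≤-trans r₀≤r (≤-trans (≤-reflexive (sym (*-identityʳ r))) (m≤n+m (r * 1) q))) ⟩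
      (q + r * 1) * q ^ r         ≤⟨ bernoulli q 1 r ⟩
      q * (q + 1) ^ r             ∎)
      where
      open ≤-Reasoning
      arith : ∀ q h p → q * (h * p) ≡ h * q * p
      arith = solve-∀

  module _ (n : ℕ) .{{n≢0 : NonZero n}} where

    private
      D = n * (b * b)
      c = b + 2
      instance
        D-nonZero : NonZero D
        D-nonZero = m*n≢0 n (b * b) {{n≢0}} {{m*n≢0 b b}}

    -- This is 1 - kc/D ≥ (1 + 1/q)/(1 + 1/b). As q is a multiple of μ, the term in k is w * (μ *
    -- k), so adding w * n to both sides exposes the hypothesis; what is left is a polynomial
    -- identity with a nonnegative remainder.
    drift : ∀ k → μ * k + n ≤ μ * n → b * D * (q + 1) ≤ (b + 1) * q * (D ∸ k * c)
    drift k h = begin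
      b * D * (q + 1)                                             ≤⟨ m+n≤o⇒m≤o∸n (b * D * (q + 1)) additive ⟩
      (b + 1) * q * D ∸ (b + 1) * q * (k * c)                     ≡⟨ sym (*-distribˡ-∸ ((b + 1) * q) D (k * c)) ⟩
      (b + 1) * q * (D ∸ k * c)                                   ∎
      where
      open ≤-Reasoning
      w = (b + 1) * (16 * μ) * c
      additive : b * D * (q + 1) + (b + 1) * q * (k * c) ≤ (b + 1) * q * D
      additive = +-cancelʳ-≤ (w * n) _ _ (begin
        b * D * (q + 1) + (b + 1) * q * (k * c) + w * n              ≡⟨ arith₁ μ n k ⟩
        b * D * (q + 1) + w * (μ * k + n)                            ≤⟨ +-monoʳ-≤ (b * D * (q + 1)) (*-monoʳ-≤ w h) ⟩
        b * D * (q + 1) + w * (μ * n)                                ≤⟨ m≤m+n _ ((10 * μ + 2) * (16 * μ * n)) ⟩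
        b * D * (q + 1) + w * (μ * n) + (10 * μ + 2) * (16 * μ * n)  ≡⟨ arith₂ μ n ⟩
        (b + 1) * q * D + w * n                                      ∎)
        where
        arith₁ : ∀ μ n k → let b = 4 * μ ; q = 16 * (μ * μ) ; c = b + 2 ; D = n * (b * b) ; w = (b + 1) * (16 * μ) * c in
                 b * D * (q + 1) + (b + 1) * q * (k * c) + w * n ≡ b * D * (q + 1) + w * (μ * k + n)
        arith₁ = solve-∀
        arith₂ : ∀ μ n → let b = 4 * μ ; q = 16 * (μ * μ) ; c = b + 2 ; D = n * (b * b) ; w = (b + 1) * (16 * μ) * c in
                 b * D * (q + 1) + w * (μ * n) + (10 * μ + 2) * (16 * μ * n) ≡ (b + 1) * q * D + w * n
        arith₂ = solve-∀

    block : ∀ k → μ * k + n ≤ μ * n → (D + c) ^ k * (b * (q + 1)) ≤ D ^ k * ((b + 1) * q)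
    block k h = *-cancelˡ-≤ D (begin
      D * ((D + c) ^ k * (b * (q + 1)))             ≡⟨ arith D ((D + c) ^ k) b (q + 1) ⟩
      (D + c) ^ k * (b * D * (q + 1))               ≤⟨ *-monoʳ-≤ ((D + c) ^ k) (drift k h) ⟩
      (D + c) ^ k * ((b + 1) * q * (D ∸ k * c))     ≡⟨ arith′ ((D + c) ^ k) ((b + 1) * q) (D ∸ k * c) ⟩
      (b + 1) * q * ((D + c) ^ k * (D ∸ k * c))     ≤⟨ *-monoʳ-≤ ((b + 1) * q) (bernoulli-∸ D c k) ⟩
      (b + 1) * q * (D * D ^ k)                     ≡⟨ arith″ ((b + 1) * q) D (D ^ k) ⟩
      D * (D ^ k * ((b + 1) * q))                   ∎)
      where
      open ≤-Reasoning
      arith : ∀ d p b q → d * (p * (b * q)) ≡ p * (b * d * q)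
      arith = solve-∀
      arith′ : ∀ p a z → p * (a * z) ≡ a * (p * z)
      arith′ = solve-∀
      arith″ : ∀ a d p → a * (d * p) ≡ d * (p * a)
      arith″ = solve-∀

    -- The T rounds fit into r blocks of n - ⌊n/μ₀⌋ rounds, one per colour. By `block` each is paid
    -- for by a factor 1 + 1/b and still gains 1 + 1/q; the gains accumulate to 2H.
    chernoff : ∀ r′ T → μ₀ ≤ n → r₀ ≤ suc r′ → μ₀ * T + suc r′ * n ≤ μ₀ * (suc r′ * n) →
               (D + c) ^ T * (b ^ r′ * H) ≤ D ^ T * (b + 1) ^ r′
    chernoff r′ T μ₀≤n r₀≤r hT = *-cancelˡ-≤ (2 * (b * q ^ r)) {{m*n≢0 2 (b * q ^ r) {{_}} {{m*n≢0 b (q ^ r) {{b-nonZero}} {{m^n≢0 q r}}}}}} (begin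
      2 * (b * q ^ r) * ((D + c) ^ T * (b ^ r′ * H))
        ≡⟨ arith₁ b (q ^ r) ((D + c) ^ T) (b ^ r′) H ⟩
      (D + c) ^ T * (b ^ r * (2 * H * q ^ r))
        ≤⟨ *-monoʳ-≤ ((D + c) ^ T) (*-monoʳ-≤ (b ^ r) (gain r r₀≤r)) ⟩
      (D + c) ^ T * (b ^ r * (q + 1) ^ r)
        ≤⟨ ^-shrink (b ^ r * (q + 1) ^ r) ((b + 1) ^ r * q ^ r) (m≤m+n D c) T≤kr long ⟩
      D ^ T * ((b + 1) * (b + 1) ^ r′ * q ^ r)
        -- The blocks use r factors b + 1, but the owner guarantees only r′; the excess (b + 1)/b ≤
        -- 2 is covered by the 2 in `gain`.
        ≤⟨ *-monoʳ-≤ (D ^ T) (*-monoˡ-≤ (q ^ r) (*-monoˡ-≤ ((b + 1) ^ r′) (+-monoʳ-≤ b (≤-trans (>-nonZero⁻¹ b) (m≤m+n b 0))))) ⟩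
      D ^ T * (2 * b * (b + 1) ^ r′ * q ^ r)
        ≡⟨ arith₂ (D ^ T) b ((b + 1) ^ r′) (q ^ r) ⟩
      2 * (b * q ^ r) * (D ^ T * (b + 1) ^ r′) ∎)
      where
      open ≤-Reasoning
      r = suc r′
      f = n / μ₀
      k = n ∸ f
      f≤n : f ≤ n
      f≤n = ≤-trans (m≤m*n f μ₀) (m/n*n≤m n μ₀)
      n≡k+f : k + f ≡ n
      n≡k+f = m∸n+n≡m f≤n
      -- Rounding n / μ₀ down loses at most a factor two, since μ₀ ≤ n makes the quotient positive.
      -- This is the 2 in `μ`.
      n≤μf : n ≤ μ * f
      n≤μf = begin
        n                     ≡⟨ m≡m%n+[m/n]*n n μ₀ ⟩
        n % μ₀ + f * μ₀       ≤⟨ +-monoˡ-≤ (f * μ₀) (<⇒≤ (m%n<n n μ₀)) ⟩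
        μ₀ + f * μ₀           ≤⟨ +-monoˡ-≤ (f * μ₀) (m≤n*m μ₀ f {{>-nonZero (m≥n⇒m/n>0 μ₀≤n)}}) ⟩
        f * μ₀ + f * μ₀       ≡⟨ arith f μ₀ ⟩
        μ * f                 ∎
        where
        arith : ∀ f m → f * m + f * m ≡ 2 * m * f
        arith = solve-∀
      slack : μ * k + n ≤ μ * n
      slack = begin
        μ * k + n             ≤⟨ +-monoʳ-≤ (μ * k) n≤μf ⟩
        μ * k + μ * f         ≡⟨ sym (*-distribˡ-+ μ k f) ⟩
        μ * (k + f)           ≡⟨ cong (μ *_) n≡k+f ⟩
        μ * n                 ∎
      T≤kr : T ≤ k * r
      T≤kr = *-cancelˡ-≤ μ₀ (+-cancelʳ-≤ (r * n) _ _ (begin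
        μ₀ * T + r * n                 ≤⟨ hT ⟩
        μ₀ * (r * n)                   ≡⟨ cong (λ s → μ₀ * (r * s)) (sym n≡k+f) ⟩
        μ₀ * (r * (k + f))             ≡⟨ arith μ₀ r k f ⟩
        μ₀ * (k * r) + r * (f * μ₀)    ≤⟨ +-monoʳ-≤ (μ₀ * (k * r)) (*-monoʳ-≤ r (m/n*n≤m n μ₀)) ⟩
        μ₀ * (k * r) + r * n           ∎))
        where
        arith : ∀ m r k f → m * (r * (k + f)) ≡ m * (k * r) + r * (f * m)
        arith = solve-∀
      long : (D + c) ^ (k * r) * (b ^ r * (q + 1) ^ r) ≤ D ^ (k * r) * ((b + 1) ^ r * q ^ r)
      long = begin
        (D + c) ^ (k * r) * (b ^ r * (q + 1) ^ r)    ≡⟨ sym (powers (D + c) b (q + 1)) ⟩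
        ((D + c) ^ k * (b * (q + 1))) ^ r            ≤⟨ ^-monoˡ-≤ r (block k slack) ⟩
        (D ^ k * ((b + 1) * q)) ^ r                  ≡⟨ powers D (b + 1) q ⟩
        D ^ (k * r) * ((b + 1) ^ r * q ^ r)          ∎
        where
        powers : ∀ x y z → (x ^ k * (y * z)) ^ r ≡ x ^ (k * r) * (y ^ r * z ^ r)
        powers x y z = trans (^-distribʳ-* r (x ^ k) (y * z)) (cong₂ _*_ (^-*-assoc x k r) (^-distribʳ-* r y z))
      arith₁ : ∀ b p x y h → 2 * (b * p) * (x * (y * h)) ≡ x * (b * y * (2 * h * p))
      arith₁ = solve-∀
      arith₂ : ∀ d b x p → d * (2 * b * x * p) ≡ 2 * (b * p) * (d * x)
      arith₂ = solve-∀

-- Integer cube roots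

ceilingCbrt : ℕ → ℕ
ceilingCbrt zero    = 0
ceilingCbrt (suc n) with suc n ≤? ceilingCbrt n ^ 3
... | yes _ = ceilingCbrt n
... | no  _ = suc (ceilingCbrt n)

n≤ceilingCbrt³ : ∀ n → n ≤ ceilingCbrt n ^ 3
n≤ceilingCbrt³ zero    = z≤n
n≤ceilingCbrt³ (suc n) with suc n ≤? ceilingCbrt n ^ 3
... | yes p = p
... | no  _ = ≤-trans (s≤s (n≤ceilingCbrt³ n)) (^-monoˡ-< 3 (n<1+n (ceilingCbrt n)))

<ceilingCbrt⇒³< : ∀ n t → t < ceilingCbrt n → t ^ 3 < n
<ceilingCbrt⇒³< (suc n) t t< with suc n ≤? ceilingCbrt n ^ 3
... | yes _ = m≤n⇒m≤1+n (<ceilingCbrt⇒³< n t t<)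
... | no ¬p = s≤s (≤-trans (^-monoˡ-≤ 3 (≤-pred t<)) (≤-pred (≰⇒> ¬p)))

ceilingCbrt-large : ∀ K n → K ^ 3 < n → K < ceilingCbrt n
ceilingCbrt-large K n K³<n = ≰⇒> (λ s≤K → <-irrefl refl
  (≤-trans K³<n (≤-trans (n≤ceilingCbrt³ n) (^-monoˡ-≤ 3 s≤K))))

-- With the root written as t + 1 ≤ 2t and 4d ≤ t, the left side is at most 4d t² ≤ t³, and t³ < n
-- by minimality of the root.
ceilingCbrt²-small : ∀ d n → .{{_ : NonZero d}} → (4 * d) ^ 3 < n → d * (ceilingCbrt n * ceilingCbrt n) ≤ n
ceilingCbrt²-small d n large with ceilingCbrt n | ceilingCbrt-large (4 * d) n large | <ceilingCbrt⇒³< n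
... | suc t | s≤s 4d≤t | below = begin
  d * (suc t * suc t)          ≤⟨ *-monoʳ-≤ d (*-mono-≤ s≤2t s≤2t) ⟩
  d * (2 * t * (2 * t))        ≡⟨ arith d t ⟩
  4 * d * (t * t)              ≤⟨ *-monoˡ-≤ (t * t) 4d≤t ⟩
  t * (t * t)                  ≡⟨ arith′ t ⟩
  t ^ 3                        ≤⟨ <⇒≤ (below t (n<1+n t)) ⟩
  n                            ∎
  where
  open ≤-Reasoning
  1≤t : 1 ≤ t
  1≤t = ≤-trans (>-nonZero⁻¹ d) (≤-trans (m≤n*m d 4) 4d≤t)
  s≤2t : suc t ≤ 2 * t
  s≤2t = ≤-trans (+-monoˡ-≤ t 1≤t) (≤-reflexive (cong (t +_) (sym (+-identityʳ t))))
  arith : ∀ d t → d * (2 * t * (2 * t)) ≡ 4 * d * (t * t)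
  arith = solve-∀
  arith′ : ∀ t → t * (t * t) ≡ t * (t * (t * 1))
  arith′ = solve-∀

-- Expected number of joined pairs

module LastColour (m r′ μ₀ : ℕ) .{{_ : NonZero μ₀}} where

  n = suc m
  N = n * m

  open Vertices n
  open Rounds n
  open Components n r′
  open Paths n r′
  open Chernoff μ₀

  private
    instance
      [b+1]-nonZero : NonZero (b + 1)
      [b+1]-nonZero = >-nonZero (m≤n+m 1 b)
      [b+1]²-nonZero : NonZero ((b + 1) * (b + 1))
      [b+1]²-nonZero = m*n≢0 (b + 1) (b + 1)
      b-nonZero : NonZero b
      b-nonZero = m*n≢0 4 (2 * μ₀) {{_}} {{m*n≢0 2 μ₀}}
      bb-nonZero : NonZero (b * b)
      bb-nonZero = m*n≢0 b b
      D-nonZero : NonZero (n * (b * b))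
      D-nonZero = m*n≢0 n (b * b)

  -- The largest arc tilt compatible with `M-small`. It is of order n, so Markov's inequality loses
  -- only a constant against the true order 1/n for an arc.
  M : ℕ
  M = m / ((b + 1) * (b + 1))

  4n≤[1+M]H : 2 * (2 * n) ≤ (1 + M) * H
  4n≤[1+M]H = begin
    2 * (2 * n)               ≡⟨ arith n ⟩
    4 * n                     ≤⟨ *-monoʳ-≤ 4 n≤ ⟩
    4 * ((1 + M) * s)         ≡⟨ arith′ (1 + M) s ⟩
    (1 + M) * (4 * s)         ∎
    where
    open ≤-Reasoning
    s = (b + 1) * (b + 1)
    arith : ∀ n → 2 * (2 * n) ≡ 4 * n
    arith = solve-∀
    arith′ : ∀ a s → 4 * (a * s) ≡ a * (4 * s)
    arith′ = solve-∀
    n≤ : n ≤ (1 + M) * s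
    n≤ = begin
      suc m                   ≡⟨ cong suc (m≡m%n+[m/n]*n m s) ⟩
      suc (m % s) + M * s     ≤⟨ +-monoˡ-≤ (M * s) (m%n<n m s) ⟩
      s + M * s               ∎

  module _ (T : ℕ) (μ₀≤n : μ₀ ≤ n) (r₀≤r : r₀ ≤ suc r′) (few-rounds : μ₀ * T + suc r′ * n ≤ μ₀ * (suc r′ * n)) where

    private
      D = n * (b * b)
      c = b + 2

    pathCount : Fin n → Steps → ℕ
    pathCount x p = ∑ (outcomes T) (λ ω → 𝟙 (Path? (history ω) x p))

    -- Bernoulli's inequality replaces 1 + kc/D by (1 + c/D)^k. The estimate for a path thereby
    -- splits into k equal factors, and `chernoff` handles each of them.
    moment-bound : ∀ k → (m * (D + k * c)) ^ T * (D ^ k) ^ T ≤ N ^ T * (b * b) ^ T * ((D + c) ^ k) ^ T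
    moment-bound k = begin
      (m * (D + k * c)) ^ T * (D ^ k) ^ T           ≡⟨ sym (^-distribʳ-* T (m * (D + k * c)) (D ^ k)) ⟩
      (m * (D + k * c) * D ^ k) ^ T                 ≤⟨ ^-monoˡ-≤ T single ⟩
      (N * (b * b) * (D + c) ^ k) ^ T               ≡⟨ ^-distribʳ-* T (N * (b * b)) ((D + c) ^ k) ⟩
      (N * (b * b)) ^ T * ((D + c) ^ k) ^ T         ≡⟨ cong (_* ((D + c) ^ k) ^ T) (^-distribʳ-* T N (b * b)) ⟩
      N ^ T * (b * b) ^ T * ((D + c) ^ k) ^ T       ∎
      where
      open ≤-Reasoning
      arith : ∀ n m s p → m * (n * s * p) ≡ n * m * s * p
      arith = solve-∀
      single : m * (D + k * c) * D ^ k ≤ N * (b * b) * (D + c) ^ k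
      single = begin
        m * (D + k * c) * D ^ k         ≡⟨ *-assoc m (D + k * c) (D ^ k) ⟩
        m * ((D + k * c) * D ^ k)       ≤⟨ *-monoʳ-≤ m (bernoulli D c k) ⟩
        m * (D * (D + c) ^ k)           ≡⟨ arith n m (b * b) ((D + c) ^ k) ⟩
        N * (b * b) * (D + c) ^ k       ∎

    chernoff-power : ∀ k → ((D + c) ^ k) ^ T * b ^ (k * r′) * H ^ k ≤ (D ^ k) ^ T * (b + 1) ^ (k * r′)
    chernoff-power k = begin
      ((D + c) ^ k) ^ T * b ^ (k * r′) * H ^ k
        ≡⟨ trans (*-assoc (((D + c) ^ k) ^ T) (b ^ (k * r′)) (H ^ k))
             (cong₂ (λ s s′ → s * (s′ * H ^ k)) (exchange (D + c)) (regroup b)) ⟩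
      ((D + c) ^ T) ^ k * ((b ^ r′) ^ k * H ^ k)
        ≡⟨ cong (((D + c) ^ T) ^ k *_) (sym (^-distribʳ-* k (b ^ r′) H)) ⟩
      ((D + c) ^ T) ^ k * (b ^ r′ * H) ^ k
        ≡⟨ sym (^-distribʳ-* k ((D + c) ^ T) (b ^ r′ * H)) ⟩
      ((D + c) ^ T * (b ^ r′ * H)) ^ k
        ≤⟨ ^-monoˡ-≤ k (chernoff n r′ T μ₀≤n r₀≤r few-rounds) ⟩
      (D ^ T * (b + 1) ^ r′) ^ k
        ≡⟨ ^-distribʳ-* k (D ^ T) ((b + 1) ^ r′) ⟩
      (D ^ T) ^ k * ((b + 1) ^ r′) ^ k
        ≡⟨ sym (cong₂ _*_ (exchange D) (regroup (b + 1))) ⟩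
      (D ^ k) ^ T * (b + 1) ^ (k * r′) ∎
      where
      open ≤-Reasoning
      exchange : ∀ x → (x ^ k) ^ T ≡ (x ^ T) ^ k
      exchange x = trans (^-*-assoc x k T) (trans (cong (x ^_) (*-comm k T)) (sym (^-*-assoc x T k)))
      regroup : ∀ x → x ^ (k * r′) ≡ (x ^ r′) ^ k
      regroup x = trans (cong (x ^_) (*-comm k r′)) (sym (^-*-assoc x r′ k))

    -- The factor 1 + M comes from realising an arc, and `H` from the overload of its owner. All
    -- remaining factors of the moment estimate cancel as X * Y * Z.
    path-bound : ∀ x p → pathCount x p * ((1 + M) * H) ^ length p ≤ N ^ T
    path-bound x p = *-cancelʳ-≤ _ _ (X * Y * Z) {{XYZ-nonZero}} (begin
      P * ((1 + M) * H) ^ k * (X * Y * Z)       ≡⟨ cong (λ s → P * s * (X * Y * Z)) (^-distribʳ-* k (1 + M) H) ⟩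
      P * (Q * H ^ k) * (X * Y * Z)             ≡⟨ arith₁ P Q (H ^ k) X Y Z ⟩
      P * (X * Y * Q) * (Z * H ^ k)             ≤⟨ *-monoˡ-≤ (Z * H ^ k) (W.path-probability M-small T x p) ⟩
      U * A ^ T * (Z * H ^ k)                   ≡⟨ arith₂ U (A ^ T) Z (H ^ k) ⟩
      U * H ^ k * (A ^ T * Z)                   ≤⟨ *-monoʳ-≤ (U * H ^ k) (moment-bound k) ⟩
      U * H ^ k * (N ^ T * Y * V)               ≡⟨ arith₃ U (H ^ k) (N ^ T) Y V ⟩
      N ^ T * Y * (V * U * H ^ k)               ≤⟨ *-monoʳ-≤ (N ^ T * Y) (chernoff-power k) ⟩
      N ^ T * Y * (Z * X)                       ≡⟨ arith₄ (N ^ T) X Y Z ⟩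
      N ^ T * (X * Y * Z)                       ∎)
      where
      open ≤-Reasoning
      module W = PathWeight m r′ b M
      M-small : M * ((b + 1) * (b + 1)) ≤ m
      M-small = m/n*n≤m m ((b + 1) * (b + 1))
      k = length p
      P = pathCount x p
      A = m * (D + k * c)
      Q = (1 + M) ^ k
      U = b ^ (k * r′)
      V = ((D + c) ^ k) ^ T
      X = (b + 1) ^ (k * r′)
      Y = (b * b) ^ T
      Z = (D ^ k) ^ T
      XYZ-nonZero : NonZero (X * Y * Z)
      XYZ-nonZero = m*n≢0 (X * Y) Z
        {{m*n≢0 X Y {{m^n≢0 (b + 1) (k * r′)}} {{m^n≢0 (b * b) T}}}}
        {{m^n≢0 (D ^ k) T {{m^n≢0 D k}}}}
      arith₁ : ∀ P Q h X Y Z → P * (Q * h) * (X * Y * Z) ≡ P * (X * Y * Q) * (Z * h)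
      arith₁ = solve-∀
      arith₂ : ∀ U A Z h → U * A * (Z * h) ≡ U * h * (A * Z)
      arith₂ = solve-∀
      arith₃ : ∀ U h N Y V → U * h * (N * Y * V) ≡ N * Y * (V * U * h)
      arith₃ = solve-∀
      arith₄ : ∀ N X Y Z → N * Y * (Z * X) ≡ N * (X * Y * Z)
      arith₄ = solve-∀

    -- There are (2n)^k words, each with probability at most (4n)^(-k); the spare 2^(-k) feeds
    -- `geometric-sum`.
    paths-of-length : ∀ x k → ∑ (words k) (pathCount x) * 2 ^ k ≤ N ^ T
    paths-of-length x k = *-cancelʳ-≤ _ _ ((2 * n) ^ k) {{m^n≢0 (2 * n) k}} (begin
      ∑ (words k) (pathCount x) * 2 ^ k * (2 * n) ^ k
        ≡⟨ trans (*-assoc (∑ (words k) (pathCount x)) (2 ^ k) ((2 * n) ^ k)) (cong (∑ (words k) (pathCount x) *_) (sym (^-distribʳ-* k 2 (2 * n)))) ⟩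
      ∑ (words k) (pathCount x) * (2 * (2 * n)) ^ k
        ≤⟨ *-monoʳ-≤ (∑ (words k) (pathCount x)) (^-monoˡ-≤ k 4n≤[1+M]H) ⟩
      ∑ (words k) (pathCount x) * ((1 + M) * H) ^ k
        ≡⟨ sym (∑-*ʳ (words k) _ (pathCount x)) ⟩
      ∑ (words k) (λ p → pathCount x p * ((1 + M) * H) ^ k)
        ≤⟨ ∑-mono-∈ (words k) (λ {p} p∈ → ≤-trans
             (≤-reflexive (cong (λ l → pathCount x p * ((1 + M) * H) ^ l) (sym (length-word k p∈)))) (path-bound x p)) ⟩
      ∑ (words k) (λ _ → N ^ T)
        ≡⟨ trans (∑-cong (words k) (λ _ → sym (*-identityʳ _))) (∑-*ˡ (words k) (N ^ T) (λ _ → 1)) ⟩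
      N ^ T * ∑ (words k) (λ _ → 1)
        ≡⟨ cong (N ^ T *_) (∑-words-1 k) ⟩
      N ^ T * (2 * n) ^ k ∎)
      where
      open ≤-Reasoning

    ∑-last-pairs-≤ : ∑ (outcomes T) (λ ω → pairs r′ (history ω)) ≤ n * (2 * N ^ T)
    ∑-last-pairs-≤ = begin
      ∑ (outcomes T) (λ ω → pairs r′ (history ω))
        ≤⟨ ∑-mono (outcomes T) (λ ω → pairs≤paths (history ω)) ⟩
      ∑ (outcomes T) (λ ω → ∑ vertices (λ x → ∑ (upTo n) (λ k → ∑ (words k) (λ p → 𝟙 (Path? (history ω) x p)))))
        ≡⟨ ∑-swap (outcomes T) vertices _ ⟩
      ∑ vertices (λ x → ∑ (outcomes T) (λ ω → ∑ (upTo n) (λ k → ∑ (words k) (λ p → 𝟙 (Path? (history ω) x p)))))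
        ≡⟨ ∑-cong vertices (λ x → trans (∑-swap (outcomes T) (upTo n) _)
             (∑-cong (upTo n) (λ k → ∑-swap (outcomes T) (words k) _))) ⟩
      ∑ vertices (λ x → ∑ (upTo n) (λ k → ∑ (words k) (pathCount x)))
        ≤⟨ ∑-bound vertices (2 * N ^ T) (λ x → geometric-sum (λ k → ∑ (words k) (pathCount x)) (N ^ T) n (paths-of-length x)) ⟩
      length vertices * (2 * N ^ T)
        ≡⟨ cong (_* (2 * N ^ T)) length-vertices ⟩
      n * (2 * N ^ T) ∎
      where open ≤-Reasoning

    ∑-totalPairs-≤ : 20 ≤ n → T ≤ suc r′ * n →
                     ∑ (outcomes T) (λ ω → totalPairs (history ω)) ≤ suc r′ * (2 ^ (6 * suc r′) + 2) * (n * N ^ T)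
    ∑-totalPairs-≤ 20≤n T≤rn = begin
      ∑ (outcomes T) (λ ω → totalPairs (history ω))
        ≡⟨ ∑-swap (outcomes T) (upTo (suc r′)) _ ⟩
      ∑ (upTo (suc r′)) (λ c → ∑ (outcomes T) (λ ω → pairs c (history ω)))
        ≤⟨ ∑-mono-∈ (upTo (suc r′)) (λ {c} c∈ → single c (Memb.∈-upTo⁻ c∈)) ⟩
      ∑ (upTo (suc r′)) (λ _ → (G + 2) * (n * N ^ T))
        ≡⟨ trans (∑-const (upTo (suc r′)) _) (cong (_* ((G + 2) * (n * N ^ T))) (length-upTo (suc r′))) ⟩
      suc r′ * ((G + 2) * (n * N ^ T))
        ≡⟨ sym (*-assoc (suc r′) (G + 2) _) ⟩
      suc r′ * (G + 2) * (n * N ^ T) ∎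
      where
      open ≤-Reasoning
      -- `G` bounds a colour below r′ and 2, from the geometric series, bounds the last one; their
      -- sum serves for every colour.
      G = 2 ^ (6 * suc r′)
      arith₁ : ∀ n g N → g * N * n ≡ g * (n * N)
      arith₁ = solve-∀
      arith₂ : ∀ n N → n * (2 * N) ≡ 2 * (n * N)
      arith₂ = solve-∀
      single : ∀ c → c < suc r′ → ∑ (outcomes T) (λ ω → pairs c (history ω)) ≤ (G + 2) * (n * N ^ T)
      single c (s≤s c≤r′) with m≤n⇒m<n∨m≡n c≤r′
      ... | inj₁ c<r′ = begin
        ∑ (outcomes T) (λ ω → pairs c (history ω))    ≤⟨ ∑-pairs-≤ c<r′ T ⟩
        (length allRounds + 2 * n) ^ T * n            ≡⟨ cong (λ s → (s + 2 * n) ^ T * n) (PositiveRounds.length-allRounds m) ⟩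
        (N + 2 * n) ^ T * n                           ≤⟨ *-monoˡ-≤ n (growth-bound m (suc r′) T 20≤n T≤rn) ⟩
        G * N ^ T * n                                 ≡⟨ arith₁ n G (N ^ T) ⟩
        G * (n * N ^ T)                               ≤⟨ *-monoˡ-≤ (n * N ^ T) (m≤m+n G 2) ⟩
        (G + 2) * (n * N ^ T)                         ∎
      ... | inj₂ refl = begin
        ∑ (outcomes T) (λ ω → pairs r′ (history ω))   ≤⟨ ∑-last-pairs-≤ ⟩
        n * (2 * N ^ T)                               ≡⟨ arith₂ n (N ^ T) ⟩
        2 * (n * N ^ T)                               ≤⟨ *-monoˡ-≤ (n * N ^ T) (m≤n+m 2 G) ⟩
        (G + 2) * (n * N ^ T)                         ∎

-- Passing between natural and rational bounds

fromℕ : ℕ → ℚ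
fromℕ a = ℤ.+ a ℚ./ 1

fromℕ-mkℚ : ∀ a → fromℕ a ≡ mkℚ (ℤ.+ a) 0 (coprime-sym (1-coprimeTo a))
fromℕ-mkℚ a = ℚ.normalize-coprime (coprime-sym (1-coprimeTo a))

fromℕ-* : ∀ a b → fromℕ (a * b) ≡ fromℕ a ℚ.* fromℕ b
fromℕ-* a b rewrite fromℕ-mkℚ a | fromℕ-mkℚ b = cong (ℚ._/ 1) (ℤ.pos-* a b)

fromℕ-+ : ∀ a b → fromℕ (a + b) ≡ fromℕ a ℚ.+ fromℕ b
fromℕ-+ a b rewrite fromℕ-mkℚ a | fromℕ-mkℚ b =
  cong (ℚ._/ 1) (trans (ℤ.pos-+ a b) (sym (cong₂ ℤ._+_ (ℤ.*-identityʳ (ℤ.+ a)) (ℤ.*-identityʳ (ℤ.+ b)))))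

fromℕ-mono : ∀ {a b} → a ≤ b → fromℕ a ℚ.≤ fromℕ b
fromℕ-mono {a} {b} a≤b rewrite fromℕ-mkℚ a | fromℕ-mkℚ b = ℚ.*≤* (ℤ.*-monoʳ-≤-nonNeg (ℤ.+ 1) (ℤ.+≤+ a≤b))

fromℕ-cancel : ∀ {a b} → fromℕ a ℚ.≤ fromℕ b → a ≤ b
fromℕ-cancel {a} {b} p rewrite fromℕ-mkℚ a | fromℕ-mkℚ b with p
... | ℚ.*≤* q = ℤ.drop‿+≤+ (ℤ.*-cancelʳ-≤-pos (ℤ.+ a) (ℤ.+ b) (ℤ.+ 1) q)

fromℕ-nonNeg : ∀ a → ℚ.NonNegative (fromℕ a)
fromℕ-nonNeg a = ℚ.nonNegative {fromℕ a} (fromℕ-mono {0} {a} z≤n)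

fromℕ-floor : ∀ p t → ℚ.floor p ≡ ℤ.+ t → fromℕ t ℚ.≤ p
fromℕ-floor p@record{} t eq rewrite fromℕ-mkℚ t =
  ℚ.*≤* (ℤ.≤-trans (ℤ.≤-reflexive (cong (ℤ._* ℚ.↧ p) (sym eq)))
        (ℤ.≤-trans (ℤ.[n/d]*d≤n (ℚ.↥ p) (ℚ.↧ p)) (ℤ.≤-reflexive (sym (ℤ.*-identityʳ (ℚ.↥ p))))))

-- The denominator of δ serves as d: the product is the numerator, a positive integer.
reciprocal-bound : ∀ δ → 0ℚ ℚ.< δ → ∃[ d ] (NonZero d × 1ℚ ℚ.≤ fromℕ d ℚ.* δ)
reciprocal-bound δ@(mkℚ (ℤ.+ zero)  d-1 _) (ℚ.*<* (ℤ.+<+ ()))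
reciprocal-bound δ@(mkℚ ℤ.-[1+ _ ]   d-1 _) (ℚ.*<* ())
reciprocal-bound δ@(mkℚ (ℤ.+ suc a) d-1 _) _ = suc d-1 , _ , bound
  where
  bound : 1ℚ ℚ.≤ fromℕ (suc d-1) ℚ.* δ
  bound rewrite fromℕ-mkℚ (suc d-1) = ℚ.toℚᵘ-cancel-≤ (ℚᵘ.≤-respʳ-≃ (ℚᵘ.≃-sym (ℚ.toℚᵘ-homo-* (mkℚ (ℤ.+ suc d-1) 0 (coprime-sym (1-coprimeTo (suc d-1)))) δ))
    (ℚᵘ.*≤* (ℤ.+≤+ (≤-trans (≤-reflexive (arith d-1)) (≤-trans (m≤m*n (suc d-1) (suc a)) (≤-reflexive (sym (*-identityʳ _))))))))
    where
    arith : ∀ d → suc (d + 0 + 0) ≡ suc d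
    arith = solve-∀

module _ (d : ℕ) (δ : ℚ) (1≤dδ : 1ℚ ℚ.≤ fromℕ d ℚ.* δ) (0<δ : 0ℚ ℚ.< δ) where

  d*a≤b⇒a≤δb : ∀ {a b} → d * a ≤ b → fromℕ a ℚ.≤ δ ℚ.* fromℕ b
  d*a≤b⇒a≤δb {a} {b} da≤b = begin
    fromℕ a                             ≡⟨ sym (ℚ.*-identityˡ (fromℕ a)) ⟩
    1ℚ ℚ.* fromℕ a                      ≤⟨ ℚ.*-monoʳ-≤-nonNeg (fromℕ a) {{fromℕ-nonNeg a}} 1≤dδ ⟩
    fromℕ d ℚ.* δ ℚ.* fromℕ a           ≡⟨ cong (ℚ._* fromℕ a) (ℚ.*-comm (fromℕ d) δ) ⟩
    δ ℚ.* fromℕ d ℚ.* fromℕ a           ≡⟨ ℚ.*-assoc δ (fromℕ d) (fromℕ a) ⟩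
    δ ℚ.* (fromℕ d ℚ.* fromℕ a)         ≡⟨ cong (δ ℚ.*_) (sym (fromℕ-* d a)) ⟩
    δ ℚ.* fromℕ (d * a)                 ≤⟨ ℚ.*-monoˡ-≤-nonNeg δ {{ℚ.nonNegative (ℚ.<⇒≤ 0<δ)}} (fromℕ-mono da≤b) ⟩
    δ ℚ.* fromℕ b                       ∎
    where open ℚ.≤-Reasoning

  complement-bound : ∀ {good bad total} → good + bad ≡ total → d * bad ≤ total → (1ℚ ℚ.- δ) ℚ.* fromℕ total ℚ.≤ fromℕ good
  complement-bound {good} {bad} {total} split db≤t = begin
    (1ℚ ℚ.- δ) ℚ.* fromℕ total                            ≡⟨ ℚ.*-distribʳ-+ (fromℕ total) 1ℚ (ℚ.- δ) ⟩
    1ℚ ℚ.* fromℕ total ℚ.+ ℚ.- δ ℚ.* fromℕ total          ≡⟨ cong₂ ℚ._+_ (trans (ℚ.*-identityˡ _) (trans (cong fromℕ (sym split)) (fromℕ-+ good bad)))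
                                                              (sym (ℚ.neg-distribˡ-* δ (fromℕ total))) ⟩
    fromℕ good ℚ.+ fromℕ bad ℚ.- δ ℚ.* fromℕ total        ≡⟨ ℚ.+-assoc (fromℕ good) (fromℕ bad) _ ⟩
    fromℕ good ℚ.+ (fromℕ bad ℚ.- δ ℚ.* fromℕ total)      ≤⟨ ℚ.+-monoʳ-≤ (fromℕ good) (ℚ.+-monoˡ-≤ (ℚ.- (δ ℚ.* fromℕ total)) (d*a≤b⇒a≤δb db≤t)) ⟩
    fromℕ good ℚ.+ (δ ℚ.* fromℕ total ℚ.- δ ℚ.* fromℕ total) ≡⟨ cong (fromℕ good ℚ.+_) (ℚ.+-inverseʳ (δ ℚ.* fromℕ total)) ⟩
    fromℕ good ℚ.+ 0ℚ                                     ≡⟨ ℚ.+-identityʳ (fromℕ good) ⟩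
    fromℕ good                                            ∎
    where open ℚ.≤-Reasoning

  [1-δ]a-bound : ∀ {a t} → fromℕ t ℚ.≤ (1ℚ ℚ.- δ) ℚ.* fromℕ a → d * t + a ≤ d * a
  [1-δ]a-bound {a} {t} t≤ = fromℕ-cancel (begin
    fromℕ (d * t + a)                                   ≡⟨ trans (fromℕ-+ (d * t) a) (cong (ℚ._+ fromℕ a) (fromℕ-* d t)) ⟩
    D ℚ.* fromℕ t ℚ.+ fromℕ a                           ≤⟨ ℚ.+-mono-≤ (ℚ.*-monoˡ-≤-nonNeg D {{fromℕ-nonNeg d}} t≤) a≤ ⟩
    D ℚ.* ((1ℚ ℚ.- δ) ℚ.* A) ℚ.+ D ℚ.* (δ ℚ.* A)        ≡⟨ sym (ℚ.*-distribˡ-+ D _ _) ⟩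
    D ℚ.* ((1ℚ ℚ.- δ) ℚ.* A ℚ.+ δ ℚ.* A)                ≡⟨ cong (D ℚ.*_) (sym (ℚ.*-distribʳ-+ A (1ℚ ℚ.- δ) δ)) ⟩
    D ℚ.* ((1ℚ ℚ.- δ ℚ.+ δ) ℚ.* A)                      ≡⟨ cong (λ s → D ℚ.* (s ℚ.* A)) (trans (ℚ.+-assoc 1ℚ (ℚ.- δ) δ) (trans (cong (1ℚ ℚ.+_) (ℚ.+-inverseˡ δ)) (ℚ.+-identityʳ 1ℚ))) ⟩
    D ℚ.* (1ℚ ℚ.* A)                                    ≡⟨ cong (D ℚ.*_) (ℚ.*-identityˡ A) ⟩
    D ℚ.* A                                             ≡⟨ sym (fromℕ-* d a) ⟩
    fromℕ (d * a)                                       ∎)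
    where
    open ℚ.≤-Reasoning
    D = fromℕ d
    A = fromℕ a
    a≤ : A ℚ.≤ D ℚ.* (δ ℚ.* A)
    a≤ = begin
      A                       ≡⟨ sym (ℚ.*-identityˡ A) ⟩
      1ℚ ℚ.* A                ≤⟨ ℚ.*-monoʳ-≤-nonNeg A {{fromℕ-nonNeg a}} 1≤dδ ⟩
      D ℚ.* δ ℚ.* A           ≡⟨ ℚ.*-assoc D δ A ⟩
      D ℚ.* (δ ℚ.* A)         ∎

  rounds-bound : .{{_ : NonZero d}} → ∀ r n → d * rounds δ r n + r * n ≤ d * (r * n)
  rounds-bound r n with ℚ.floor ((1ℚ ℚ.- δ) ℚ.* fromℕ (r * n)) in eq
  ... | ℤ.+ t    = [1-δ]a-bound {r * n} {t} (fromℕ-floor _ t eq)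
  -- A negative floor occurs only for ε > 1, and then there are no rounds.
  ... | ℤ.-[1+ _ ] = ≤-trans (≤-reflexive (cong (_+ r * n) (*-zeroʳ d))) (m≤n*m (r * n) d)

-- Markov's inequality and the conclusion

sizeBound : ℕ → ℕ
sizeBound n = ceilingCbrt n * ceilingCbrt n

sizeBound-littleO : LittleO sizeBound
sizeBound-littleO δ 0<δ with reciprocal-bound δ 0<δ
... | d , d≢0 , 1≤dδ = suc ((4 * d) ^ 3) , λ n large →
  d*a≤b⇒a≤δb d δ 1≤dδ 0<δ (ceilingCbrt²-small d n {{d≢0}} large)

module _ (n r′ : ℕ) where

  open Rounds n
  open Components n r′

  totalPairs⇒bounded : ∀ {T} (ω : Vec (Round n) T) f → totalPairs (history ω) ≤ f * f →
                       ComponentsBoundedBy f (run (algorithm n r′) ω)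
  totalPairs⇒bounded ω f total≤ c x ys ys! connected = ≮⇒≥ (λ f<len → <-irrefl refl (begin-strict
    f * f                         <⟨ *-mono-< f<len f<len ⟩
    length ys * length ys         ≤⟨ component²≤pairs (toℕ c) (history ω) x ys! (All.map (connected⇒Conn ω c) connected) ⟩
    pairs (toℕ c) (history ω)     ≤⟨ ∈⇒≤∑ (λ c → pairs c (history ω)) (Memb.∈-upTo⁺ (Fin.toℕ<n c)) ⟩
    totalPairs (history ω)        ≤⟨ total≤ ⟩
    f * f                         ∎))
    where open ≤-Reasoning

module _ (m r′ μ₀ : ℕ) .{{_ : NonZero μ₀}} (T : ℕ) (d : ℕ) where

  private
    n = suc m
    N = n * m
    s = ceilingCbrt n
    f = sizeBound n
    K = suc r′ * (2 ^ (6 * suc r′) + 2)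

  open Rounds n
  open Components n r′
  open Chernoff μ₀

  bounded? : (ω : Vec (Round n) T) → Dec (totalPairs (history ω) ≤ f * f)
  bounded? ω = totalPairs (history ω) ≤? f * f

  failures : ℕ
  failures = ∑ (outcomes T) (λ ω → 𝟙 (¬? (bounded? ω)))

  module _ (μ₀≤n : μ₀ ≤ n) (20≤n : 20 ≤ n) (r₀≤r : r₀ ≤ suc r′)
           (few-rounds : μ₀ * T + suc r′ * n ≤ μ₀ * (suc r′ * n)) (large : (K * d) ^ 3 < n) where

    T≤rn : T ≤ suc r′ * n
    T≤rn = *-cancelˡ-≤ μ₀ (≤-trans (m≤m+n _ _) few-rounds)

    K*d<s : K * d < s
    K*d<s = ceilingCbrt-large (K * d) n large

    markov : failures * (f * f) ≤ K * (n * N ^ T)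
    markov = begin
      failures * (f * f)                                    ≡⟨ sym (∑-*ʳ (outcomes T) (f * f) _) ⟩
      ∑ (outcomes T) (λ ω → 𝟙 (¬? (bounded? ω)) * (f * f))  ≤⟨ ∑-mono (outcomes T) (λ ω → pointwise ω (bounded? ω)) ⟩
      ∑ (outcomes T) (λ ω → totalPairs (history ω))         ≤⟨ LastColour.∑-totalPairs-≤ m r′ μ₀ T μ₀≤n r₀≤r few-rounds 20≤n T≤rn ⟩
      K * (n * N ^ T)                                       ∎
      where
      open ≤-Reasoning
      pointwise : ∀ ω (b? : Dec (totalPairs (history ω) ≤ f * f)) → 𝟙 (¬? b?) * (f * f) ≤ totalPairs (history ω)
      pointwise ω (yes _) = z≤n
      pointwise ω (no ¬b) = ≤-trans (≤-reflexive (*-identityˡ (f * f))) (<⇒≤ (≰⇒> ¬b))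

    -- As n ≤ s^3 and f * f = s^4, `markov` bounds the proportion of failures by K / s, which is
    -- below 1 / d because K * d < s.
    failures-rare : d * failures ≤ N ^ T
    failures-rare = *-cancelˡ-≤ K {{K-nonZero}} (*-cancelˡ-≤ (s ^ 3) {{m^n≢0 s 3 {{>-nonZero (≤-trans (s≤s z≤n) K*d<s)}}}} (begin
      s ^ 3 * (K * (d * failures))      ≡⟨ arith₁ (s ^ 3) K d failures ⟩
      K * d * (failures * s ^ 3)        ≤⟨ *-monoˡ-≤ (failures * s ^ 3) (<⇒≤ K*d<s) ⟩
      s * (failures * s ^ 3)            ≡⟨ arith₂ s failures ⟩
      failures * (f * f)                ≤⟨ markov ⟩
      K * (n * N ^ T)                   ≤⟨ *-monoʳ-≤ K (*-monoˡ-≤ (N ^ T) (n≤ceilingCbrt³ n)) ⟩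
      K * (s ^ 3 * N ^ T)               ≡⟨ arith₃ K (s ^ 3) (N ^ T) ⟩
      s ^ 3 * (K * N ^ T)               ∎))
      where
      open ≤-Reasoning
      K-nonZero : NonZero K
      K-nonZero = m*n≢0 (suc r′) (2 ^ (6 * suc r′) + 2) {{_}} {{>-nonZero (≤-trans (s≤s z≤n) (m≤n+m 2 _))}}
      arith₁ : ∀ c K d x → c * (K * (d * x)) ≡ K * d * (x * c)
      arith₁ = solve-∀
      arith₂ : ∀ s x → s * (x * (s * (s * (s * 1)))) ≡ x * (s * s * (s * s))
      arith₂ = solve-∀
      arith₃ : ∀ K c N → K * (c * N) ≡ c * (K * N)
      arith₃ = solve-∀

    bounded-likely : ∀ η → 1ℚ ℚ.≤ fromℕ d ℚ.* η → 0ℚ ℚ.< η →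
      ProbAtLeast (Outcome (algorithm n r′) T) (outcomeCount (algorithm n r′) T)
                  (λ ω → ComponentsBoundedBy f (run (algorithm n r′) ω)) (1ℚ ℚ.- η)
    bounded-likely η 1≤dη 0<η =
        filter bounded? (outcomes T)
      , filter⁺ bounded? (outcomes-unique T)
      , All.map (λ {ω} → totalPairs⇒bounded n r′ ω f) (All.all-filter bounded? (outcomes T))
      , complement-bound d η 1≤dη 0<η split (≤-trans failures-rare (≤-reflexive (sym count)))
      where
      count : outcomeCount (algorithm n r′) T ≡ N ^ T
      -- Edges times two seeds are exactly the ordered pairs of distinct vertices.
      count = cong (_^ T) (nC2*2≡n*[n-1] m)
      split : length (filter bounded? (outcomes T)) + failures ≡ outcomeCount (algorithm n r′) T
      split = trans (length-filter-¬ bounded? (outcomes T)) (trans (PositiveRounds.length-outcomes m T) (sym count))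

bounded-whp : ∀ μ₀ .{{_ : NonZero μ₀}} r′ → Chernoff.r₀ μ₀ ≤ suc r′ → (T : ℕ → ℕ) →
  (∀ n → μ₀ * T n + suc r′ * n ≤ μ₀ * (suc r′ * n)) →
  WHP (λ n → Outcome (algorithm n r′) (T n))
      (λ n → outcomeCount (algorithm n r′) (T n))
      (λ n ω → ComponentsBoundedBy (sizeBound n) (run (algorithm n r′) ω))
bounded-whp μ₀ r′ r₀≤r T few-rounds η 0<η with reciprocal-bound η 0<η
-- The sum of the three thresholds stands in for their maximum and also rules out n = 0.
... | d , _ , 1≤dη = μ₀ + (20 + suc ((K * d) ^ 3)) , likely
  where
  K = suc r′ * (2 ^ (6 * suc r′) + 2)
  likely : ∀ n → μ₀ + (20 + suc ((K * d) ^ 3)) ≤ n →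
           ProbAtLeast (Outcome (algorithm n r′) (T n)) (outcomeCount (algorithm n r′) (T n))
                       (λ ω → ComponentsBoundedBy (sizeBound n) (run (algorithm n r′) ω)) (1ℚ ℚ.- η)
  likely zero    large = contradiction (m+n≤o⇒n≤o μ₀ large) (λ ())
  likely (suc m) large = bounded-likely m r′ μ₀ (T (suc m)) d
    (m+n≤o⇒m≤o μ₀ large)
    (m+n≤o⇒m≤o 20 (m+n≤o⇒n≤o μ₀ large))
    r₀≤r
    (few-rounds (suc m))
    (m+n≤o⇒n≤o 20 (m+n≤o⇒n≤o μ₀ large))
    η 1≤dη 0<η

theorem1p2 : (ε : ℚ) → 0ℚ ℚ.< ε →
    Σ ℕ λ r₀ → ((r : ℕ) → r₀ ≤ r →
    Σ ((n : ℕ) → OnlineAlgorithm n r) λ A → Σ (ℕ → ℕ) λ f → (LittleO f ×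
    WHP (λ n → Outcome (A n) (rounds ε r n))
    (λ n → outcomeCount (A n) (rounds ε r n))
    (λ n ω → ComponentsBoundedBy (f n) (run (A n) ω))))
theorem1p2 ε 0<ε =
  let μ₀ , μ₀≢0 , 1≤μ₀ε = reciprocal-bound ε 0<ε
  -- The extra successor excludes r = 0, where there is no last colour to fall back on.
  in suc (Chernoff.r₀ μ₀ {{μ₀≢0}}) , λ
  { zero ()
  ; (suc r′) (s≤s r₀≤r′) →
      (λ n → algorithm n r′) , sizeBound , sizeBound-littleO
    , bounded-whp μ₀ {{μ₀≢0}} r′ (m≤n⇒m≤1+n r₀≤r′) (rounds ε (suc r′))
        (rounds-bound μ₀ ε 1≤μ₀ε 0<ε {{μ₀≢0}} (suc r′))
  }
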